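{- Let $n>k>t$ be positive integers and suppose that the nonempty family $\mathcal F\subset\binom{[n]}{k}$ is a $t$-intersecting $(t+1)$-semistar. Then for all integers $1<j<t$, $$\frac{|\partial^j\mathcal F|}{|\mathcal F|}\ \ge\ \frac{1}{t+2}\binom{t+2}{j+1}.$$
   Context: $[n]=\{1,\dots,n\}$, and $\binom{[n]}{k}$ is the collection of all $k$-element subsets of $[n]$. A family $\mathcal F\subset\binom{[n]}{k}$ is $t$-intersecting if $|F\cap F'|\ge t$ for all $F,F'\in\mathcal F$. The $j$'th shadow is $\partial^j\mathcal F=\{G\in\binom{[n]}{k-j} : \exists F\in\mathcal F,\ G\subset F\}$. $\mathcal F$ is a $(t+1)$-semistar if there is a $(t+1)$-element set $D\subset[n]$ such that $|F\cap D|\ge t$ for all $F\in\mathcal F$. -}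

module Defs where

open import Data.Fin.Subset using (Subset; inside; outside; _⊆_; _∩_; ∣_∣)
open import Data.Fin.Subset.Properties using (anySubset?; _⊆?_)
open import Data.List.Base using (List; []; _∷_; [_]; _++_; map; filter; length)
open import Data.List.Membership.Propositional using () renaming (_∈_ to _∈ˡ_)
open import Data.List.Membership.Propositional.Properties
  using (∈-map⁺; ∈-++⁺ˡ; ∈-++⁺ʳ; ∈-filter⁺; ∈-length)
open import Data.List.Relation.Unary.Any using (here)
open import Data.Nat.Base using (ℕ; zero; suc; _+_; _≤_; NonZero; >-nonZero)
open import Data.Nat.Properties using (_≟_)
open import Data.Product.Base using (_×_; _,_; ∃-syntax)
open import Data.Vec.Base using ([]; _∷_)
open import Level using (0ℓ)
open import Relation.Binary.PropositionalEquality using (_≡_; refl)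
open import Relation.Nullary.Decidable using (_×-dec_)
open import Relation.Unary using (Pred; Decidable; _∈_; Satisfiable)

-- A subset of [n] is an element of Subset n (the ground set being Fin n), and
-- a family of subsets is a predicate on Subset n. Decidability of the
-- predicate, automatic classically, is what makes its cardinality computable.

Family : ℕ → Set₁
Family n = Pred (Subset n) 0ℓ

-- Every subset of Fin n, each listed exactly once.

subsets : ∀ n → List (Subset n)
subsets zero    = [ [] ]
subsets (suc n) = map (inside ∷_) (subsets n) ++ map (outside ∷_) (subsets n)

∈-subsets : ∀ {n} (A : Subset n) → A ∈ˡ subsets n
∈-subsets []            = here refl
∈-subsets (inside  ∷ A) = ∈-++⁺ˡ (∈-map⁺ (inside ∷_) (∈-subsets A))
∈-subsets {suc n} (outside ∷ A) =
  ∈-++⁺ʳ (map (inside ∷_) (subsets n)) (∈-map⁺ (outside ∷_) (∈-subsets A))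

card : ∀ {n} {𝓕 : Family n} → Decidable 𝓕 → ℕ
card {n} 𝓕? = length (filter 𝓕? (subsets n))

card-nonZero : ∀ {n} {𝓕 : Family n} (𝓕? : Decidable 𝓕) →
               Satisfiable 𝓕 → NonZero (card 𝓕?)
card-nonZero 𝓕? (F , F∈𝓕) =
  >-nonZero (∈-length (∈-filter⁺ 𝓕? (∈-subsets F) F∈𝓕))

Uniform : ∀ {n} → ℕ → Family n → Set
Uniform k 𝓕 = ∀ {F} → F ∈ 𝓕 → ∣ F ∣ ≡ k

-- F and F′ are not required to be distinct.

Intersecting : ∀ {n} → ℕ → Family n → Set
Intersecting t 𝓕 = ∀ {F F′} → F ∈ 𝓕 → F′ ∈ 𝓕 → t ≤ ∣ F ∩ F′ ∣

-- SucSemistar t is the notion of a (t+1)-semistar.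

SucSemistar : ∀ {n} → ℕ → Family n → Set
SucSemistar {n} t 𝓕 =
  ∃[ D ] ∣ D ∣ ≡ suc t × (∀ {F : Subset n} → F ∈ 𝓕 → t ≤ ∣ F ∩ D ∣)

-- The j'th shadow of a k-uniform family. The condition ∣ G ∣ = k - j is
-- written additively, so that no G qualifies when j > k.

shadow : ∀ {n} → (k j : ℕ) → Family n → Family n
shadow k j 𝓕 G = ∣ G ∣ + j ≡ k × ∃[ F ] (F ∈ 𝓕 × G ⊆ F)

shadow? : ∀ {n} k j {𝓕 : Family n} → Decidable 𝓕 → Decidable (shadow k j 𝓕)
shadow? k j 𝓕? G =
  (∣ G ∣ + j ≟ k) ×-dec anySubset? (λ F → 𝓕? F ×-dec (G ⊆? F))

-- Let D be the (t+1)-set of the semistar, A₀ the family of F \ D for members F ⊇ D, and A_l that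
-- for the members missing exactly l ∈ D. Since 𝓕 is t-intersecting, A_l and A_l′ are
-- cross-intersecting for l ≢ l′, and then |∂A_l| ≥ |A_l| or |∂A_l′| ≥ |A_l′|: after compression,
-- if both failed, each family would contain a set no initial segment of which has a majority in it,
-- and two such sets can be compressed to disjoint ones. So |∂A_l| ≥ |A_l| for all l but one, say e.
-- The traces outside D of those members of ∂ʲ𝓕 that miss exactly T ⊆ D include A_l for all l ∈ T
-- when |T| = j + 1, and A₀ as well as ∂A_l for all l ∈ T when |T| = j. Bounding the largest of
-- these from below by averages over l ≢ e and summing over T gives the claim.
module Submission where

module SemistarShadow where

  open import Defs
  open import Data.Bool.Base using (Bool; true; false; T; _∧_; _∨_; if_then_else_)
  open import Data.Bool.Properties using (T-∧; T-∨; ∧-identityʳ; ∧-zeroʳ)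
  open import Data.Empty using (⊥-elim)
  open import Data.Fin.Base using (Fin; zero; suc; punchIn)
  import Data.Fin.Properties as Fin
  open import Data.Fin.Subset using (Subset; inside; outside; _∈_; _⊆_; _⊂_; _∩_; ∁; ⊥; ⁅_⁆; ∣_∣)
  open import Data.Fin.Subset.Properties
  import Data.Integer.Base as ℤ
  import Data.Integer.Properties as ℤ
  import Data.List.Base as List
  open import Data.List.Properties using (map-++; map-∘)
  open import Data.Nat.Base
  open import Data.Nat.Combinatorics using (_C_; nCk≡nC[n∸k]; nCn≡1; nCk+nC[k+1]≡[n+1]C[k+1]; k>n⇒nCk≡0)
  open import Data.Nat.Induction using (<-wellFounded)
  import Data.Nat.ListAction as ℕ
  open import Data.Nat.ListAction.Properties using (sum-++)
  open import Data.Nat.Properties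
  open import Algebra.Properties.CommutativeMonoid.Sum +-0-commutativeMonoid using (sum; sum-remove)
  open import Data.Nat.Tactic.RingSolver using (solve-∀)
  open import Data.Product.Base using (_×_; _,_; proj₁; proj₂; ∃-syntax)
  import Data.Rational.Base as ℚ
  import Data.Rational.Properties as ℚ
  import Data.Rational.Unnormalised.Base as ℚᵘ
  import Data.Rational.Unnormalised.Properties as ℚᵘ
  open import Data.Sum.Base using (_⊎_; inj₁; inj₂; [_,_]′; map)
  open import Data.Unit.Base using (tt)
  open import Data.Vec.Base using ([]; _∷_; insertAt; here; there)
  open import Data.Vec.Properties using (lookup⇒[]=; []=⇒lookup; insertAt-punchIn; insertAt-lookup)
  open import Function.Base using (_∘_; id)
  open import Function.Bundles using (Equivalence)
  open import Induction.WellFounded using (Acc; acc)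
  open import Relation.Binary.PropositionalEquality
  open import Relation.Nullary.Decidable using (yes; no; ⌊_⌋; toWitness; fromWitness)
  open import Relation.Nullary.Negation using (contradiction)
  open import Relation.Unary using (Decidable)
  open Equivalence using (to; from)

  -- Sums over all subsets of the ground set.

  ∑ : ∀ {n} → (Subset n → ℕ) → ℕ
  ∑ {zero}  f = f []
  ∑ {suc n} f = ∑ (f ∘ (inside ∷_)) + ∑ (f ∘ (outside ∷_))

  ∑-cong : ∀ {n} {f g : Subset n → ℕ} → (∀ X → f X ≡ g X) → ∑ f ≡ ∑ g
  ∑-cong {zero}  f≗g = f≗g []
  ∑-cong {suc n} f≗g = cong₂ _+_ (∑-cong (f≗g ∘ (inside ∷_))) (∑-cong (f≗g ∘ (outside ∷_)))

  ∑-mono : ∀ {n} {f g : Subset n → ℕ} → (∀ X → f X ≤ g X) → ∑ f ≤ ∑ g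
  ∑-mono {zero}  f≤g = f≤g []
  ∑-mono {suc n} f≤g = +-mono-≤ (∑-mono (f≤g ∘ (inside ∷_))) (∑-mono (f≤g ∘ (outside ∷_)))

  interchange : ∀ a b c d → (a + b) + (c + d) ≡ (a + c) + (b + d)
  interchange = solve-∀

  x+[y+z]≡y+[x+z] : ∀ x y z → x + (y + z) ≡ y + (x + z)
  x+[y+z]≡y+[x+z] = solve-∀

  x*[y*z]≡y*[x*z] : ∀ x y z → x * (y * z) ≡ y * (x * z)
  x*[y*z]≡y*[x*z] = solve-∀

  regroup : ∀ a b c d → (a + b) + (c + d) ≡ a + (b + c) + d
  regroup = solve-∀

  ∑-+ : ∀ {n} (f g : Subset n → ℕ) → ∑ (λ X → f X + g X) ≡ ∑ f + ∑ g
  ∑-+ {zero}  f g = refl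
  ∑-+ {suc n} f g =
    trans (cong₂ _+_ (∑-+ (f ∘ (inside ∷_)) (g ∘ (inside ∷_)))
                     (∑-+ (f ∘ (outside ∷_)) (g ∘ (outside ∷_))))
          (interchange (∑ (f ∘ (inside ∷_))) _ (∑ (f ∘ (outside ∷_))) _)

  ∑-zero : ∀ {n} {f : Subset n → ℕ} → (∀ X → f X ≡ 0) → ∑ f ≡ 0
  ∑-zero {zero}  f≗0 = f≗0 []
  ∑-zero {suc n} f≗0 = cong₂ _+_ (∑-zero (f≗0 ∘ (inside ∷_))) (∑-zero (f≗0 ∘ (outside ∷_)))

  +-tightˡ : ∀ {a b c d} → a ≤ c → b ≤ d → c + d ≤ a + b → c ≤ a
  +-tightˡ {a} {b} {c} {d} a≤c b≤d c+d≤a+b =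
    +-cancelʳ-≤ d c a (≤-trans c+d≤a+b (+-monoʳ-≤ a b≤d))

  +-tightʳ : ∀ {a b c d} → a ≤ c → b ≤ d → c + d ≤ a + b → d ≤ b
  +-tightʳ {a} {b} {c} {d} a≤c b≤d c+d≤a+b =
    +-cancelˡ-≤ c d b (≤-trans c+d≤a+b (+-monoˡ-≤ b a≤c))

  -- Slack at one point cannot be made up elsewhere. This later turns an unchanged total weight into
  -- a statement about every single set.
  ∑-tight : ∀ {n} {f g : Subset n → ℕ} → (∀ X → f X ≤ g X) → ∑ g ≤ ∑ f → ∀ X → g X ≤ f X
  ∑-tight f≤g g≤f []             = g≤f
  ∑-tight f≤g g≤f (inside  ∷ X) =
    ∑-tight (f≤g ∘ (inside ∷_))
      (+-tightˡ (∑-mono (f≤g ∘ (inside ∷_))) (∑-mono (f≤g ∘ (outside ∷_))) g≤f) X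
  ∑-tight f≤g g≤f (outside ∷ X) =
    ∑-tight (f≤g ∘ (outside ∷_))
      (+-tightʳ (∑-mono (f≤g ∘ (inside ∷_))) (∑-mono (f≤g ∘ (outside ∷_))) g≤f) X

  ∑<⇒∃ : ∀ {n} (f g : Subset n → ℕ) → ∑ f < ∑ g → ∃[ X ] f X < g X
  ∑<⇒∃ {zero}  f g f<g = [] , f<g
  ∑<⇒∃ {suc n} f g f<g with ∑ (f ∘ (inside ∷_)) <? ∑ (g ∘ (inside ∷_))
  ... | yes p = let X , q = ∑<⇒∃ (f ∘ (inside ∷_)) (g ∘ (inside ∷_)) p in inside ∷ X , q
  ... | no ¬p with ∑ (f ∘ (outside ∷_)) <? ∑ (g ∘ (outside ∷_))
  ...   | yes p = let X , q = ∑<⇒∃ (f ∘ (outside ∷_)) (g ∘ (outside ∷_)) p in outside ∷ X , q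
  ...   | no ¬q = contradiction f<g (≤⇒≯ (+-mono-≤ (≮⇒≥ ¬p) (≮⇒≥ ¬q)))

  -- Boolean families, their sizes and their one-step shadows.

  Fam : ℕ → Set
  Fam n = Subset n → Bool

  ind : Bool → ℕ
  ind b = if b then 1 else 0

  ind-mono : ∀ {a b} → (T a → T b) → ind a ≤ ind b
  ind-mono {false} {b}     f = z≤n
  ind-mono {true}  {false} f = ⊥-elim (f tt)
  ind-mono {true}  {true}  f = s≤s z≤n

  # : ∀ {n} → Fam n → ℕ
  # A = ∑ (ind ∘ A)

  infix 4 _⊑_

  _⊑_ : ∀ {n} → Fam n → Fam n → Set
  A ⊑ B = ∀ X → T (A X) → T (B X)

  #-mono : ∀ {n} {A B : Fam n} → A ⊑ B → # A ≤ # B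
  #-mono A⊑B = ∑-mono (λ X → ind-mono (A⊑B X))

  -- The one-step shadow, by recursion on the ground set: a set omitting the first element arises by
  -- deleting either a later element or the first one.
  ∂ : ∀ {n} → Fam n → Fam n
  ∂ A []            = false
  ∂ A (inside  ∷ X) = ∂ (A ∘ (inside ∷_)) X
  ∂ A (outside ∷ X) = ∂ (A ∘ (outside ∷_)) X ∨ A (inside ∷ X)

  ∨-map : ∀ {a b c d} → (T a → T c) → (T b → T d) → T (a ∨ b) → T (c ∨ d)
  ∨-map {true}  {b}    {true}  f g _ = tt
  ∨-map {true}  {b}    {false} f g _ = ⊥-elim (f tt)
  ∨-map {false} {true} {c}     f g _ = from T-∨ (inj₂ (g tt))

  ∂-mono : ∀ {n} {A B : Fam n} → A ⊑ B → ∂ A ⊑ ∂ B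
  ∂-mono A⊑B (inside  ∷ X) = ∂-mono (A⊑B ∘ (inside ∷_)) X
  ∂-mono {A = A} A⊑B (outside ∷ X) =
    ∨-map {∂ (A ∘ (outside ∷_)) X} (∂-mono (A⊑B ∘ (outside ∷_)) X) (A⊑B (inside ∷ X))

  ∂-∨ : ∀ {n} (A B : Fam n) → ∂ (λ X → A X ∨ B X) ⊑ (λ X → ∂ A X ∨ ∂ B X)
  ∂-∨ A B (inside  ∷ X) t = ∂-∨ (A ∘ (inside ∷_)) (B ∘ (inside ∷_)) X t
  ∂-∨ A B (outside ∷ X) t =
    exchange (∂ (A ∘ (outside ∷_)) X) (∂ (B ∘ (outside ∷_)) X)
      (∨-map {∂ (λ Y → A (outside ∷ Y) ∨ B (outside ∷ Y)) X}
        (∂-∨ (A ∘ (outside ∷_)) (B ∘ (outside ∷_)) X) id t)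
    where
    exchange : ∀ a b {c d} → T ((a ∨ b) ∨ (c ∨ d)) → T ((a ∨ c) ∨ (b ∨ d))
    exchange true  b             _ = tt
    exchange false true  {true}  _ = tt
    exchange false true  {false} _ = tt
    exchange false false         t = t

  ∂-sound : ∀ {n} (A : Fam n) Y → T (∂ A Y) →
            ∃[ X ] T (A X) × Y ⊆ X × ∣ X ∣ ≡ suc ∣ Y ∣
  ∂-sound A (inside ∷ Y) t =
    let X , X∈A , Y⊆X , eq = ∂-sound (A ∘ (inside ∷_)) Y t
    in inside ∷ X , X∈A , s⊆s Y⊆X , cong suc eq
  ∂-sound A (outside ∷ Y) t with to (T-∨ {∂ (A ∘ (outside ∷_)) Y}) t
  ... | inj₁ u =
    let X , X∈A , Y⊆X , eq = ∂-sound (A ∘ (outside ∷_)) Y u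
    in outside ∷ X , X∈A , s⊆s Y⊆X , eq
  ... | inj₂ u = inside ∷ Y , u , out⊆ id , refl

  -- Sets with a surplus on an initial segment.

  -- hit h X holds when some initial segment, possibly empty, of the ground set contains at least h
  -- more elements of X than non-elements.
  hit : ∀ {n} → ℕ → Subset n → Bool
  hit zero    X             = true
  hit (suc h) []            = false
  hit (suc h) (inside  ∷ X) = hit h X
  hit (suc h) (outside ∷ X) = hit (suc (suc h)) X

  _∩hit_ : ∀ {n} → Fam n → ℕ → Fam n
  (A ∩hit h) X = A X ∧ hit h X

  #-∩hit-zero : ∀ {n} (A : Fam n) → # (A ∩hit 0) ≡ # A
  #-∩hit-zero A = ∑-cong (λ X → cong ind (∧-identityʳ (A X)))

  -- The recursion hides an injection A → ∂A on the sets satisfying hit 1: bracketing elements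
  -- against earlier non-elements, remove the last unmatched element.
  #∩hit≤#∂ : ∀ {n} h (A : Fam n) → # (A ∩hit (suc h)) ≤ # (∂ A ∩hit h)
  #∩hit≤#∂ {zero} h A = ≤-trans (≤-reflexive (cong ind (∧-zeroʳ (A [])))) z≤n
  #∩hit≤#∂ {suc n} (suc h) A =
    +-mono-≤ (#∩hit≤#∂ h (A ∘ (inside ∷_)))
      (≤-trans (#∩hit≤#∂ (suc (suc h)) (A ∘ (outside ∷_)))
               (∑-mono (λ X → weaken (∂ (A ∘ (outside ∷_)) X) _ _)))
    where
    weaken : ∀ a b c → ind (a ∧ c) ≤ ind ((a ∨ b) ∧ c)
    weaken true  b c = ≤-refl
    weaken false b c = z≤n
  -- A set in both `A₁` and `∂ A₀` contributes only once to the shadow. If it satisfies `hit 1`, its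
  -- second copy is charged to `A₁ ∩hit 1`, which the induction hypothesis bounds by the shadow of
  -- `A₁`; hence this term is added on both sides.
  #∩hit≤#∂ {suc n} zero A = +-cancelʳ-≤ (# (A₁ ∩hit 1)) _ _ (begin
      # (A₁ ∩hit 0) + # (A₀ ∩hit 2) + # (A₁ ∩hit 1)
        ≤⟨ +-mono-≤ (+-monoʳ-≤ (# (A₁ ∩hit 0)) (#∩hit≤#∂ 1 A₀)) (#∩hit≤#∂ 0 A₁) ⟩
      # (A₁ ∩hit 0) + # (∂ A₀ ∩hit 1) + # (∂ A₁ ∩hit 0)
        ≤⟨ +-monoˡ-≤ _ pointwise ⟩
      # ((λ X → ∂ A₀ X ∨ A₁ X) ∩hit 0) + # (A₁ ∩hit 1) + # (∂ A₁ ∩hit 0)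
        ≡⟨ rotate (# ((λ X → ∂ A₀ X ∨ A₁ X) ∩hit 0)) (# (A₁ ∩hit 1)) (# (∂ A₁ ∩hit 0)) ⟩
      # (∂ A₁ ∩hit 0) + # ((λ X → ∂ A₀ X ∨ A₁ X) ∩hit 0) + # (A₁ ∩hit 1) ∎)
    where
    open ≤-Reasoning
    A₁ A₀ : Fam n
    A₁ = A ∘ (inside ∷_)
    A₀ = A ∘ (outside ∷_)

    rotate : ∀ a b c → a + b + c ≡ c + a + b
    rotate = solve-∀

    cases : ∀ a b h → ind (a ∧ true) + ind (b ∧ h) ≤ ind ((b ∨ a) ∧ true) + ind (a ∧ h)
    cases true  true  true  = ≤-refl
    cases true  true  false = ≤-refl
    cases true  false true  = n≤1+n 1
    cases true  false false = ≤-refl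
    cases false true  true  = ≤-refl
    cases false true  false = z≤n
    cases false false h     = z≤n

    pointwise : # (A₁ ∩hit 0) + # (∂ A₀ ∩hit 1)
              ≤ # ((λ X → ∂ A₀ X ∨ A₁ X) ∩hit 0) + # (A₁ ∩hit 1)
    pointwise = subst₂ _≤_
      (∑-+ (ind ∘ (A₁ ∩hit 0)) (ind ∘ (∂ A₀ ∩hit 1)))
      (∑-+ (ind ∘ ((λ X → ∂ A₀ X ∨ A₁ X) ∩hit 0)) (ind ∘ (A₁ ∩hit 1)))
      (∑-mono (λ X → cases (A₁ X) (∂ A₀ X) (hit 1 X)))

  -- At most `# (∂ A)` members satisfy `hit 1`, so a smaller shadow leaves a member that fails it.
  ∃-noHit : ∀ {n} (A : Fam n) → # (∂ A) < # A → ∃[ X ] T (A X) × hit 1 X ≡ false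
  ∃-noHit A ∂A<A =
    let X , q = ∑<⇒∃ (ind ∘ (A ∩hit 1)) (ind ∘ A)
                  (≤-<-trans (≤-trans (#∩hit≤#∂ 0 A) (≤-reflexive (#-∩hit-zero (∂ A)))) ∂A<A)
    in X , read (A X) (hit 1 X) q
    where
    read : ∀ a h → ind (a ∧ h) < ind a → T a × h ≡ false
    read true  true  (s≤s ())
    read true  false _  = tt , refl
    read false h     ()

  -- Compression by adjacent shifts.

  -- Only shifts between neighbouring positions are needed: stability under them already gives
  -- stability under the whole componentwise order ≼.
  shift : ∀ {n} → Fin n → Fam (suc n) → Fam (suc n)
  shift zero A (inside  ∷ inside  ∷ X) = A (inside ∷ inside ∷ X)
  shift zero A (inside  ∷ outside ∷ X) = A (inside ∷ outside ∷ X) ∨ A (outside ∷ inside ∷ X)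
  shift zero A (outside ∷ inside  ∷ X) = A (inside ∷ outside ∷ X) ∧ A (outside ∷ inside ∷ X)
  shift zero A (outside ∷ outside ∷ X) = A (outside ∷ outside ∷ X)
  shift (suc i) A (x ∷ X) = shift i (A ∘ (x ∷_)) X

  Cross : ∀ {n} → Fam n → Fam n → Set
  Cross A B = ∀ X Y → T (A X) → T (B Y) → 1 ≤ ∣ X ∩ Y ∣

  -- The critical pair has one set at the earlier and one at the later of the two positions. The
  -- later one survives the shift only if its swap is in the family too, so whichever original the
  -- other set comes from has a partner disjoint from it at these positions, and the common element
  -- lies elsewhere.
  shift-cross : ∀ {n} (i : Fin n) {A B : Fam (suc n)} → Cross A B → Cross (shift i A) (shift i B)
  shift-cross (suc i) c (inside  ∷ X) (inside  ∷ Y) p q = s≤s z≤n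
  shift-cross (suc i) c (inside  ∷ X) (outside ∷ Y) p q =
    shift-cross i (λ X Y → c (inside ∷ X) (outside ∷ Y)) X Y p q
  shift-cross (suc i) c (outside ∷ X) (inside  ∷ Y) p q =
    shift-cross i (λ X Y → c (outside ∷ X) (inside ∷ Y)) X Y p q
  shift-cross (suc i) c (outside ∷ X) (outside ∷ Y) p q =
    shift-cross i (λ X Y → c (outside ∷ X) (outside ∷ Y)) X Y p q
  shift-cross zero c (inside  ∷ X)           (inside  ∷ Y)           p q = s≤s z≤n
  shift-cross zero c (inside  ∷ inside  ∷ X) (outside ∷ inside  ∷ Y) p q = s≤s z≤n
  shift-cross zero c (outside ∷ inside  ∷ X) (inside  ∷ inside  ∷ Y) p q = s≤s z≤n
  shift-cross zero c (outside ∷ inside  ∷ X) (outside ∷ inside  ∷ Y) p q = s≤s z≤n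
  shift-cross zero c (inside  ∷ inside  ∷ X) (outside ∷ outside ∷ Y) p q =
    c (inside ∷ inside ∷ X) (outside ∷ outside ∷ Y) p q
  shift-cross zero {A} {B} c (inside ∷ outside ∷ X) (outside ∷ inside ∷ Y) p q
    with to (T-∨ {A (inside ∷ outside ∷ X)}) p | to (T-∧ {B (inside ∷ outside ∷ Y)}) q
  ... | inj₁ p′ | _ , q′ = c (inside ∷ outside ∷ X) (outside ∷ inside ∷ Y) p′ q′
  ... | inj₂ p′ | q′ , _ = c (outside ∷ inside ∷ X) (inside ∷ outside ∷ Y) p′ q′
  shift-cross zero {A} c (inside ∷ outside ∷ X) (outside ∷ outside ∷ Y) p q
    with to (T-∨ {A (inside ∷ outside ∷ X)}) p
  ... | inj₁ p′ = c (inside ∷ outside ∷ X) (outside ∷ outside ∷ Y) p′ q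
  ... | inj₂ p′ = c (outside ∷ inside ∷ X) (outside ∷ outside ∷ Y) p′ q
  shift-cross zero {A} {B} c (outside ∷ inside ∷ X) (inside ∷ outside ∷ Y) p q
    with to (T-∧ {A (inside ∷ outside ∷ X)}) p | to (T-∨ {B (inside ∷ outside ∷ Y)}) q
  ... | _ , p′ | inj₁ q′ = c (outside ∷ inside ∷ X) (inside ∷ outside ∷ Y) p′ q′
  ... | p′ , _ | inj₂ q′ = c (inside ∷ outside ∷ X) (outside ∷ inside ∷ Y) p′ q′
  shift-cross zero {A} c (outside ∷ inside ∷ X) (outside ∷ outside ∷ Y) p q =
    c (outside ∷ inside ∷ X) (outside ∷ outside ∷ Y) (proj₂ (to (T-∧ {A (inside ∷ outside ∷ X)}) p)) q
  shift-cross zero c (outside ∷ outside ∷ X) (inside ∷ inside ∷ Y) p q =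
    c (outside ∷ outside ∷ X) (inside ∷ inside ∷ Y) p q
  shift-cross zero {B = B} c (outside ∷ outside ∷ X) (inside ∷ outside ∷ Y) p q
    with to (T-∨ {B (inside ∷ outside ∷ Y)}) q
  ... | inj₁ q′ = c (outside ∷ outside ∷ X) (inside ∷ outside ∷ Y) p q′
  ... | inj₂ q′ = c (outside ∷ outside ∷ X) (outside ∷ inside ∷ Y) p q′
  shift-cross zero {B = B} c (outside ∷ outside ∷ X) (outside ∷ inside ∷ Y) p q =
    c (outside ∷ outside ∷ X) (outside ∷ inside ∷ Y) p (proj₂ (to (T-∧ {B (inside ∷ outside ∷ Y)}) q))
  shift-cross zero c (outside ∷ outside ∷ X) (outside ∷ outside ∷ Y) p q =
    c (outside ∷ outside ∷ X) (outside ∷ outside ∷ Y) p q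

  shift-mono : ∀ {n} (i : Fin n) {A B : Fam (suc n)} → A ⊑ B → shift i A ⊑ shift i B
  shift-mono (suc i) A⊑B (x ∷ X) = shift-mono i (A⊑B ∘ (x ∷_)) X
  shift-mono zero A⊑B (inside  ∷ inside  ∷ X) = A⊑B _
  shift-mono zero {A} A⊑B (inside  ∷ outside ∷ X) = ∨-map {A (inside ∷ outside ∷ X)} (A⊑B _) (A⊑B _)
  shift-mono zero {A} A⊑B (outside ∷ inside  ∷ X) t =
    let p , q = to (T-∧ {A (inside ∷ outside ∷ X)}) t in from T-∧ (A⊑B _ p , A⊑B _ q)
  shift-mono zero A⊑B (outside ∷ outside ∷ X) = A⊑B _

  -- As shifts preserve size, this says that they never enlarge the shadow's size, so a bound for
  -- the shifted family passes back to the original one.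
  ∂-shift : ∀ {n} (i : Fin n) (A : Fam (suc n)) → ∂ (shift i A) ⊑ shift i (∂ A)
  ∂-shift (suc i) A (inside  ∷ X) t = ∂-shift i (A ∘ (inside ∷_)) X t
  ∂-shift (suc i) A (outside ∷ X) t with to (T-∨ {∂ (shift i (A ∘ (outside ∷_))) X}) t
  ... | inj₁ u = shift-mono i (λ Y v → from T-∨ (inj₁ v)) X (∂-shift i (A ∘ (outside ∷_)) X u)
  ... | inj₂ u = shift-mono i (λ Y v → from (T-∨ {∂ (A ∘ (outside ∷_)) Y}) (inj₂ v)) X u
  ∂-shift zero A (inside ∷ inside ∷ X) t = t
  ∂-shift zero A (inside ∷ outside ∷ X) t
    with to (T-∨ {∂ (λ Y → A (inside ∷ outside ∷ Y) ∨ A (outside ∷ inside ∷ Y)) X}) t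
  ... | inj₂ u = from T-∨ (inj₁ (from (T-∨ {∂ (A ∘ (inside ∷_) ∘ (outside ∷_)) X}) (inj₂ u)))
  ... | inj₁ u = ∨-map {∂ (A ∘ (inside ∷_) ∘ (outside ∷_)) X} (from T-∨ ∘ inj₁) (from T-∨ ∘ inj₁)
                   (∂-∨ (A ∘ (inside ∷_) ∘ (outside ∷_)) (A ∘ (outside ∷_) ∘ (inside ∷_)) X u)
  ∂-shift zero A (outside ∷ inside ∷ X) t
    with to (T-∨ {∂ (λ Y → A (inside ∷ outside ∷ Y) ∧ A (outside ∷ inside ∷ Y)) X}) t
  ... | inj₂ u = from T-∧ ( from (T-∨ {∂ (A ∘ (inside ∷_) ∘ (outside ∷_)) X}) (inj₂ u)
                          , from (T-∨ {∂ (A ∘ (outside ∷_) ∘ (inside ∷_)) X}) (inj₂ u))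
  ... | inj₁ u = from T-∧
    ( from T-∨ (inj₁ (∂-mono (λ Y v → proj₁ (to T-∧ v)) X u))
    , from T-∨ (inj₁ (∂-mono (λ Y v → proj₂ (to (T-∧ {A (inside ∷ outside ∷ Y)}) v)) X u)))
  ∂-shift zero A (outside ∷ outside ∷ X) t =
    regroupᵀ (∂ (A ∘ (outside ∷_) ∘ (outside ∷_)) X) (A (inside ∷ outside ∷ X)) t
    where
    regroupᵀ : ∀ a b {c} → T ((a ∨ (b ∧ c)) ∨ (b ∨ c)) → T ((a ∨ c) ∨ b)
    regroupᵀ true  b             _ = tt
    regroupᵀ false true  {true}  _ = tt
    regroupᵀ false true  {false} _ = tt
    regroupᵀ false false {true}  _ = tt

  infix 4 _≼_

  data _≼_ : ∀ {n} → Subset n → Subset n → Set where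
    ≼-refl  : ∀ {n} {X : Subset n} → X ≼ X
    ≼-trans : ∀ {n} {X Y Z : Subset n} → X ≼ Y → Y ≼ Z → X ≼ Z
    ≼-cons  : ∀ {n} x {X Y : Subset n} → X ≼ Y → x ∷ X ≼ x ∷ Y
    ≼-swap  : ∀ {n} (X : Subset n) → inside ∷ outside ∷ X ≼ outside ∷ inside ∷ X

  -- Shifts preserve size, so containment in the shifted family already means being fixed by the
  -- shift.
  Compressed : ∀ {n} → Fam (suc n) → Set
  Compressed {n} A = ∀ (i : Fin n) → A ⊑ shift i A

  ≼-closed : ∀ {n} {A : Fam (suc n)} → Compressed A → ∀ {X Y} → X ≼ Y → T (A Y) → T (A X)
  ≼-closed c ≼-refl                         t = t
  ≼-closed c (≼-trans p q)                  t = ≼-closed c p (≼-closed c q t)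
  ≼-closed {suc n}     c (≼-cons x p)       t = ≼-closed (λ i X → c (suc i) (x ∷ X)) p t
  ≼-closed {zero}      c (≼-cons x {[]} {[]} p) t = t
  ≼-closed {suc n} {A} c (≼-swap X)         t =
    proj₁ (to (T-∧ {A (inside ∷ outside ∷ X)}) (c zero (outside ∷ inside ∷ X) t))

  #-shift : ∀ {n} (i : Fin n) (A : Fam (suc n)) → # (shift i A) ≡ # A
  #-shift (suc i) A = cong₂ _+_ (#-shift i (A ∘ (inside ∷_))) (#-shift i (A ∘ (outside ∷_)))
  #-shift {suc n} zero A = begin
      # ii + ∑ (λ X → ind (io X ∨ oi X)) + (∑ (λ X → ind (io X ∧ oi X)) + # oo)
        ≡⟨ regroup (# ii) _ _ (# oo) ⟩
      # ii + (∑ (λ X → ind (io X ∨ oi X)) + ∑ (λ X → ind (io X ∧ oi X))) + # oo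
        ≡⟨ cong (λ x → # ii + x + # oo) middle ⟩
      # ii + (# io + # oi) + # oo
        ≡⟨ regroup (# ii) _ _ (# oo) ⟨
      # ii + # io + (# oi + # oo) ∎
    where
    open ≡-Reasoning
    ii io oi oo : Fam n
    ii X = A (inside ∷ inside ∷ X)
    io X = A (inside ∷ outside ∷ X)
    oi X = A (outside ∷ inside ∷ X)
    oo X = A (outside ∷ outside ∷ X)

    ind-∨-∧ : ∀ a b → ind (a ∨ b) + ind (a ∧ b) ≡ ind a + ind b
    ind-∨-∧ true  true  = refl
    ind-∨-∧ true  false = refl
    ind-∨-∧ false b     = +-identityʳ (ind b)

    middle : ∑ (λ X → ind (io X ∨ oi X)) + ∑ (λ X → ind (io X ∧ oi X)) ≡ # io + # oi
    middle = trans (sym (∑-+ {n} _ _)) (trans (∑-cong (λ X → ind-∨-∧ (io X) (oi X))) (∑-+ {n} _ _))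

  -- Weights that detect compressed families.

  -- The weight drops strictly when an element moves one place towards the front at the positions
  -- affected by `shift i`. Strictness lets an unchanged weight certify an unchanged family.
  Descending : ∀ {n} → Fin n → (Subset (suc n) → ℕ) → Set
  Descending zero    v = ∀ X → v (inside ∷ outside ∷ X) < v (outside ∷ inside ∷ X)
  Descending (suc i) v = ∀ x → Descending i (v ∘ (x ∷_))

  weight : ∀ {n} → (Subset n → ℕ) → Fam n → ℕ
  weight v A = ∑ (λ X → ind (A X) * v X)

  module _ {n} (v : Subset (2+ n) → ℕ) (desc : Descending zero v) (A : Fam (2+ n)) where
    private
      a b : Fam n
      a X = A (inside ∷ outside ∷ X)
      b X = A (outside ∷ inside ∷ X)

      va vb : Subset n → ℕ
      va X = v (inside ∷ outside ∷ X)
      vb X = v (outside ∷ inside ∷ X)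

      old new : Subset n → ℕ
      old X = ind (a X) * va X + ind (b X) * vb X
      new X = ind (a X ∨ b X) * va X + ind (a X ∧ b X) * vb X

      pair-≤ : ∀ a b {x y} → x < y → ind (a ∨ b) * x + ind (a ∧ b) * y ≤ ind a * x + ind b * y
      pair-≤ true  true  x<y = ≤-refl
      pair-≤ true  false x<y = ≤-refl
      pair-≤ false true  {x} {y} x<y = begin
        1 * x + 0 ≡⟨ +-identityʳ (1 * x) ⟩
        1 * x     ≤⟨ *-monoʳ-≤ 1 (<⇒≤ x<y) ⟩
        1 * y     ∎
        where open ≤-Reasoning
      pair-≤ false false x<y = ≤-refl

      pair-tight : ∀ a b {x y} → x < y →
        ind a * x + ind b * y ≤ ind (a ∨ b) * x + ind (a ∧ b) * y → T b → T (a ∧ b)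
      pair-tight true  true  x<y _   _ = tt
      pair-tight false true  {x} {y} x<y y≤x _ = contradiction (begin
        y         ≡⟨ *-identityˡ y ⟨
        1 * y     ≤⟨ y≤x ⟩
        1 * x + 0 ≡⟨ trans (+-identityʳ (1 * x)) (*-identityˡ x) ⟩
        x         ∎) (<⇒≱ x<y)
        where open ≤-Reasoning

      new≤old : ∀ X → new X ≤ old X
      new≤old X = pair-≤ (a X) (b X) (desc X)

      ii oo : ℕ
      ii = ∑ (λ X → ind (A (inside ∷ inside ∷ X)) * v (inside ∷ inside ∷ X))
      oo = ∑ (λ X → ind (A (outside ∷ outside ∷ X)) * v (outside ∷ outside ∷ X))

      weight-old : weight v A ≡ ii + ∑ old + oo
      weight-old = trans (regroup ii _ _ oo)
        (cong (λ x → ii + x + oo)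
          (sym (∑-+ (λ X → ind (a X) * va X) (λ X → ind (b X) * vb X))))

      weight-new : weight v (shift zero A) ≡ ii + ∑ new + oo
      weight-new = trans (regroup ii _ _ oo)
        (cong (λ x → ii + x + oo)
          (sym (∑-+ (λ X → ind (a X ∨ b X) * va X) (λ X → ind (a X ∧ b X) * vb X))))

    weight-shift-zero : weight v (shift zero A) ≤ weight v A
    weight-shift-zero = subst₂ _≤_ (sym weight-new) (sym weight-old)
      (+-monoˡ-≤ oo (+-monoʳ-≤ ii (∑-mono new≤old)))

    -- If `outside ∷ inside ∷ X` were present without its swap, the shift would replace it by the
    -- lighter swap, and no other pair could compensate.
    weight-tight-zero : weight v A ≤ weight v (shift zero A) → A ⊑ shift zero A
    weight-tight-zero tight = λ where
        (inside  ∷ inside  ∷ X) t → t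
        (inside  ∷ outside ∷ X) t → from T-∨ (inj₁ t)
        (outside ∷ inside  ∷ X) t →
          pair-tight (a X) (b X) (desc X) (∑-tight new≤old ∑old≤∑new X) t
        (outside ∷ outside ∷ X) t → t
      where
      ∑old≤∑new : ∑ old ≤ ∑ new
      ∑old≤∑new = +-cancelˡ-≤ ii (∑ old) (∑ new)
        (+-cancelʳ-≤ oo (ii + ∑ old) (ii + ∑ new) (subst₂ _≤_ weight-old weight-new tight))

  weight-shift : ∀ {n} (i : Fin n) v → Descending i v → (A : Fam (suc n)) →
                 weight v (shift i A) ≤ weight v A
  weight-shift {suc n} zero v desc A = weight-shift-zero v desc A
  weight-shift (suc i) v desc A = +-mono-≤ (weight-shift i (v ∘ (inside ∷_)) (desc inside) (A ∘ (inside ∷_)))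
                                         (weight-shift i (v ∘ (outside ∷_)) (desc outside) (A ∘ (outside ∷_)))

  weight-tight : ∀ {n} (i : Fin n) v → Descending i v → (A : Fam (suc n)) →
                 weight v A ≤ weight v (shift i A) → A ⊑ shift i A
  weight-tight {suc n} zero v desc A tight = weight-tight-zero v desc A tight
  weight-tight (suc i) v desc A tight (inside ∷ X) =
    weight-tight i (v ∘ (inside ∷_)) (desc inside) (A ∘ (inside ∷_))
      (+-tightˡ (weight-shift i (v ∘ (inside ∷_)) (desc inside) (A ∘ (inside ∷_)))
                (weight-shift i (v ∘ (outside ∷_)) (desc outside) (A ∘ (outside ∷_))) tight) X
  weight-tight (suc i) v desc A tight (outside ∷ X) =
    weight-tight i (v ∘ (outside ∷_)) (desc outside) (A ∘ (outside ∷_))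
      (+-tightʳ (weight-shift i (v ∘ (inside ∷_)) (desc inside) (A ∘ (inside ∷_)))
                (weight-shift i (v ∘ (outside ∷_)) (desc outside) (A ∘ (outside ∷_))) tight) X

  position-sum : ∀ {n} → ℕ → Subset n → ℕ
  position-sum c []            = 0
  position-sum c (inside  ∷ X) = c + position-sum (suc c) X
  position-sum c (outside ∷ X) = position-sum (suc c) X

  descending-+ : ∀ {n} (i : Fin n) {v} c → Descending i v → Descending i (λ X → c + v X)
  descending-+ zero    c desc X = +-monoʳ-< c (desc X)
  descending-+ (suc i) c desc x = descending-+ i c (desc x)

  position-sum-descending : ∀ {n} (i : Fin n) c → Descending i (position-sum c)
  position-sum-descending zero    c X       = n<1+n _
  position-sum-descending (suc i) c inside  = descending-+ i c (position-sum-descending i (suc c))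
  position-sum-descending (suc i) c outside = position-sum-descending i (suc c)

  -- Moving two sets apart.

  -- When the first element of `Q` moves to the front, the non-elements before it stay in `R`; so
  -- `R` attains surplus `suc h` only if `Q` attains `suc (suc h)`.
  pull : ∀ {n} h (Q : Subset (suc n)) → hit (suc (suc h)) Q ≡ false →
         ∣ Q ∣ ≡ 0 ⊎ ∃[ R ] inside ∷ R ≼ Q × hit (suc h) R ≡ false
  pull h (inside ∷ Q) e = inj₂ (Q , ≼-refl , e)
  pull {zero}  h (outside ∷ []) e = inj₁ refl
  pull {suc n} h (outside ∷ Q)  e with pull (suc h) Q e
  ... | inj₁ empty          = inj₁ empty
  ... | inj₂ (R , R≼Q , e′) = inj₂ (outside ∷ R , ≼-trans (≼-swap R) (≼-cons outside R≼Q) , e′)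

  ∣p∣≡0⇒∣q∩p∣≡0 : ∀ {n} (P Q : Subset n) → ∣ Q ∣ ≡ 0 → ∣ P ∩ Q ∣ ≡ 0
  ∣p∣≡0⇒∣q∩p∣≡0 P Q e = n≤0⇒n≡0 (≤-trans (∣p∩q∣≤∣q∣ P Q) (≤-reflexive e))

  -- The two sets take turns: at each point the one whose turn it is pulls an element there, while
  -- the surplus condition keeps that point out of the other.
  disjoint-below : ∀ {n} (P Q : Subset n) → hit 1 P ≡ false → hit 2 Q ≡ false →
                   ∃[ P′ ] ∃[ Q′ ] P′ ≼ P × Q′ ≼ Q × ∣ P′ ∩ Q′ ∣ ≡ 0
  disjoint-below []            []      _ _ = [] , [] , ≼-refl , ≼-refl , refl
  disjoint-below (outside ∷ P) Q       e f with pull 0 Q f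
  ... | inj₁ empty = outside ∷ P , Q , ≼-refl , ≼-refl , ∣p∣≡0⇒∣q∩p∣≡0 (outside ∷ P) Q empty
  ... | inj₂ (R , R≼Q , g) =
    -- The roles swap: behind its leading non-element `P` is only kept below surplus 2, while `R`,
    -- having spent an element, is kept below 1.
    let R′ , P′ , R′≼R , P′≼P , d = disjoint-below R P g e
    in outside ∷ P′ , inside ∷ R′ , ≼-cons outside P′≼P , ≼-trans (≼-cons inside R′≼R) R≼Q
       , trans (cong ∣_∣ (∩-comm P′ R′)) d

  hit-antitone : ∀ {n} h (X : Subset n) → hit h X ≡ false → hit (suc h) X ≡ false
  hit-antitone (suc h)       []            e = refl
  hit-antitone (suc h)       (inside  ∷ X) e = hit-antitone h X e
  hit-antitone (suc h)       (outside ∷ X) e = hit-antitone (suc (suc h)) X e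

  -- Shadows of cross-intersecting families.

  compressed-cross⇒shadow : ∀ {n} {A B : Fam (suc n)} → Compressed A → Compressed B → Cross A B →
                            # A ≤ # (∂ A) ⊎ # B ≤ # (∂ B)
  compressed-cross⇒shadow {A = A} {B} cA cB cross with # A ≤? # (∂ A) | # B ≤? # (∂ B)
  ... | yes p | _     = inj₁ p
  ... | no _  | yes q = inj₂ q
  ... | no p  | no q  =
    let X , X∈A , e = ∃-noHit A (≰⇒> p)
        Y , Y∈B , f = ∃-noHit B (≰⇒> q)
        -- Staying below surplus 1, `Y` also stays below 2, the bound for the set that pulls first.
        X′ , Y′ , X′≼X , Y′≼Y , d = disjoint-below X Y e (hit-antitone 1 Y f)
    in contradiction (cross X′ Y′ (≼-closed cA X′≼X X∈A) (≼-closed cB Y′≼Y Y∈B))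
                     (<⇒≱ (s≤s (≤-reflexive d)))

  private
    positions : ∀ {n} → Fam n → ℕ
    positions = weight (position-sum 0)

  -- `Cross` survives when both families are shifted at the same position, so the induction runs on
  -- their joint weight. When no shift lowers it, neither weight drops separately, and both families
  -- are compressed.
  cross⇒shadow-acc : ∀ {n} (A B : Fam (suc n)) → Acc _<_ (positions A + positions B) →
                     Cross A B → # A ≤ # (∂ A) ⊎ # B ≤ # (∂ B)
  cross⇒shadow-acc A B (acc rs) cross
    with Fin.any? (λ i → positions (shift i A) + positions (shift i B) <? positions A + positions B)
  ... | yes (i , decrease) =
    map (back A) (back B) (cross⇒shadow-acc (shift i A) (shift i B) (rs decrease) (shift-cross i cross))
    where
    back : ∀ C → # (shift i C) ≤ # (∂ (shift i C)) → # C ≤ # (∂ C)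
    back C p = begin
      # C               ≡⟨ #-shift i C ⟨
      # (shift i C)     ≤⟨ p ⟩
      # (∂ (shift i C)) ≤⟨ #-mono (∂-shift i C) ⟩
      # (shift i (∂ C)) ≡⟨ #-shift i (∂ C) ⟩
      # (∂ C)           ∎
      where open ≤-Reasoning
  ... | no stuck = compressed-cross⇒shadow
    (λ i → weight-tight i (position-sum 0) (desc i) A
      (+-tightˡ (weight-shift i (position-sum 0) (desc i) A) (weight-shift i (position-sum 0) (desc i) B) (tight i)))
    (λ i → weight-tight i (position-sum 0) (desc i) B
      (+-tightʳ (weight-shift i (position-sum 0) (desc i) A) (weight-shift i (position-sum 0) (desc i) B) (tight i)))
    cross
    where
    desc : ∀ i → Descending i (position-sum 0)
    desc i = position-sum-descending i 0

    tight : ∀ i → positions A + positions B ≤ positions (shift i A) + positions (shift i B)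
    tight i = ≮⇒≥ (λ decrease → stuck (i , decrease))

  cross⇒shadow : ∀ {n} (A B : Fam n) → Cross A B → # A ≤ # (∂ A) ⊎ # B ≤ # (∂ B)
  cross⇒shadow {suc n} A B cross = cross⇒shadow-acc A B (<-wellFounded _) cross
  cross⇒shadow {zero}  A B cross with A [] in a | B [] in b
  ... | false | _     = inj₁ z≤n
  ... | true  | false = inj₂ z≤n
  ... | true  | true  = contradiction (cross [] [] (subst T (sym a) tt) (subst T (sym b) tt)) λ ()

  -- Sums over subsets of fixed size.

  ∑[_] : ∀ {n} → ℕ → (Subset n → ℕ) → ℕ
  ∑[_] {zero}  zero    f = f []
  ∑[_] {zero}  (suc k) f = 0
  ∑[_] {suc n} zero    f = ∑[ zero ] (f ∘ (outside ∷_))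
  ∑[_] {suc n} (suc k) f = ∑[ k ] (f ∘ (inside ∷_)) + ∑[ suc k ] (f ∘ (outside ∷_))

  nC0≡1 : ∀ n → n C 0 ≡ 1
  nC0≡1 n = trans (nCk≡nC[n∸k] {0} {n} z≤n) (nCn≡1 n)

  ∑[]-const : ∀ n k c → ∑[_] {n} k (λ _ → c) ≡ (n C k) * c
  ∑[]-const zero    zero    c = sym (*-identityˡ c)
  ∑[]-const zero    (suc k) c = cong (_* c) (sym (k>n⇒nCk≡0 {0} {suc k} z<s))
  ∑[]-const (suc n) zero    c = begin
    ∑[_] {n} 0 (λ _ → c) ≡⟨ ∑[]-const n 0 c ⟩
    (n C 0) * c          ≡⟨ cong (_* c) (trans (nC0≡1 n) (sym (nC0≡1 (suc n)))) ⟩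
    (suc n C 0) * c      ∎
    where open ≡-Reasoning
  ∑[]-const (suc n) (suc k) c = begin
    ∑[_] {n} k (λ _ → c) + ∑[_] {n} (suc k) (λ _ → c) ≡⟨ cong₂ _+_ (∑[]-const n k c) (∑[]-const n (suc k) c) ⟩
    (n C k) * c + (n C suc k) * c                     ≡⟨ *-distribʳ-+ c (n C k) (n C suc k) ⟨
    (n C k + n C suc k) * c                           ≡⟨ cong (_* c) (nCk+nC[k+1]≡[n+1]C[k+1] n k) ⟩
    (suc n C suc k) * c                               ∎
    where open ≡-Reasoning

  ∑[]-mono : ∀ {n} k {f g : Subset n → ℕ} → (∀ T → ∣ T ∣ ≡ k → f T ≤ g T) → ∑[ k ] f ≤ ∑[ k ] g
  ∑[]-mono {zero}  zero    f≤g = f≤g [] refl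
  ∑[]-mono {zero}  (suc k) f≤g = z≤n
  ∑[]-mono {suc n} zero    f≤g = ∑[]-mono zero (f≤g ∘ (outside ∷_))
  ∑[]-mono {suc n} (suc k) f≤g =
    +-mono-≤ (∑[]-mono k (λ T e → f≤g (inside ∷ T) (cong suc e)))
             (∑[]-mono (suc k) (f≤g ∘ (outside ∷_)))

  ∑[]-+ : ∀ {n} k (f g : Subset n → ℕ) → ∑[ k ] (λ T → f T + g T) ≡ ∑[ k ] f + ∑[ k ] g
  ∑[]-+ {zero}  zero    f g = refl
  ∑[]-+ {zero}  (suc k) f g = refl
  ∑[]-+ {suc n} zero    f g = ∑[]-+ zero (f ∘ (outside ∷_)) (g ∘ (outside ∷_))
  ∑[]-+ {suc n} (suc k) f g =
    trans (cong₂ _+_ (∑[]-+ k (f ∘ (inside ∷_)) (g ∘ (inside ∷_)))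
                     (∑[]-+ (suc k) (f ∘ (outside ∷_)) (g ∘ (outside ∷_))))
          (interchange (∑[ k ] (f ∘ (inside ∷_))) _ (∑[ suc k ] (f ∘ (outside ∷_))) _)

  ∑[]-* : ∀ {n} k c (f : Subset n → ℕ) → ∑[ k ] (λ T → c * f T) ≡ c * ∑[ k ] f
  ∑[]-* {zero}  zero    c f = refl
  ∑[]-* {zero}  (suc k) c f = sym (*-zeroʳ c)
  ∑[]-* {suc n} zero    c f = ∑[]-* zero c (f ∘ (outside ∷_))
  ∑[]-* {suc n} (suc k) c f =
    trans (cong₂ _+_ (∑[]-* k c (f ∘ (inside ∷_))) (∑[]-* (suc k) c (f ∘ (outside ∷_))))
          (sym (*-distribˡ-+ c (∑[ k ] (f ∘ (inside ∷_))) _))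

  ∑[k]≤∑ : ∀ {n} k (f : Subset n → ℕ) → ∑[ k ] f ≤ ∑ f
  ∑[k]≤∑ {zero}  zero    f = ≤-refl
  ∑[k]≤∑ {zero}  (suc k) f = z≤n
  ∑[k]≤∑ {suc n} zero    f = ≤-trans (∑[k]≤∑ zero (f ∘ (outside ∷_))) (m≤n+m _ _)
  ∑[k]≤∑ {suc n} (suc k) f = +-mono-≤ (∑[k]≤∑ k (f ∘ (inside ∷_))) (∑[k]≤∑ (suc k) (f ∘ (outside ∷_)))

  -- Different levels are disjoint parts of the full sum. Two neighbouring ones suffice, since the
  -- final count uses only the traces missing `j` or `j + 1` points of `D`.
  ∑[k]+∑[1+k]≤∑ : ∀ {n} k (f : Subset n → ℕ) → ∑[ k ] f + ∑[ suc k ] f ≤ ∑ f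
  ∑[k]+∑[1+k]≤∑ {zero}  zero    f = ≤-reflexive (+-identityʳ _)
  ∑[k]+∑[1+k]≤∑ {zero}  (suc k) f = z≤n
  ∑[k]+∑[1+k]≤∑ {suc n} zero    f = begin
    ∑[ 0 ] f₀ + (∑[ 0 ] f₁ + ∑[ 1 ] f₀) ≡⟨ x+[y+z]≡y+[x+z] (∑[ 0 ] f₀) (∑[ 0 ] f₁) (∑[ 1 ] f₀) ⟩
    ∑[ 0 ] f₁ + (∑[ 0 ] f₀ + ∑[ 1 ] f₀) ≤⟨ +-mono-≤ (∑[k]≤∑ 0 f₁) (∑[k]+∑[1+k]≤∑ 0 f₀) ⟩
    ∑ f₁ + ∑ f₀                         ∎
    where
    open ≤-Reasoning
    f₁ f₀ : Subset n → ℕ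
    f₁ = f ∘ (inside ∷_)
    f₀ = f ∘ (outside ∷_)
  ∑[k]+∑[1+k]≤∑ {suc n} (suc k) f = begin
    ∑[ suc k ] f + ∑[ 2+ k ] f
      ≡⟨ interchange (∑[ k ] f₁) (∑[ suc k ] f₀) (∑[ suc k ] f₁) (∑[ 2+ k ] f₀) ⟩
    (∑[ k ] f₁ + ∑[ suc k ] f₁) + (∑[ suc k ] f₀ + ∑[ 2+ k ] f₀)
      ≤⟨ +-mono-≤ (∑[k]+∑[1+k]≤∑ k f₁) (∑[k]+∑[1+k]≤∑ (suc k) f₀) ⟩
    ∑ f₁ + ∑ f₀ ∎
    where
    open ≤-Reasoning
    f₁ f₀ : Subset n → ℕ
    f₁ = f ∘ (inside ∷_)
    f₀ = f ∘ (outside ∷_)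

  -- Summation by complements and by a distinguished element.

  ∑-∁ : ∀ {n} (f : Subset n → ℕ) → ∑ f ≡ ∑ (f ∘ ∁)
  ∑-∁ {zero}  f = refl
  ∑-∁ {suc n} f = trans (+-comm (∑ (f ∘ (inside ∷_))) _)
    (cong₂ _+_ (∑-∁ (f ∘ (outside ∷_))) (∑-∁ (f ∘ (inside ∷_))))

  ∑-insertAt : ∀ {n} (e : Fin (suc n)) (f : Subset (suc n) → ℕ) →
    ∑ f ≡ ∑ (λ T → f (insertAt T e inside)) + ∑ (λ T → f (insertAt T e outside))
  ∑-insertAt zero    f = refl
  ∑-insertAt {suc n} (suc e) f =
    trans (cong₂ _+_ (∑-insertAt e (f ∘ (inside ∷_))) (∑-insertAt e (f ∘ (outside ∷_))))
          (interchange (∑ (λ T → f (inside ∷ insertAt T e inside))) _ _ _)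

  ∣insertAt-inside∣ : ∀ {n} (T : Subset n) e → ∣ insertAt T e inside ∣ ≡ suc ∣ T ∣
  ∣insertAt-inside∣ T             zero    = refl
  ∣insertAt-inside∣ (inside  ∷ T) (suc e) = cong suc (∣insertAt-inside∣ T e)
  ∣insertAt-inside∣ (outside ∷ T) (suc e) = ∣insertAt-inside∣ T e

  ∣insertAt-outside∣ : ∀ {n} (T : Subset n) e → ∣ insertAt T e outside ∣ ≡ ∣ T ∣
  ∣insertAt-outside∣ T             zero    = refl
  ∣insertAt-outside∣ (inside  ∷ T) (suc e) = cong suc (∣insertAt-outside∣ T e)
  ∣insertAt-outside∣ (outside ∷ T) (suc e) = ∣insertAt-outside∣ T e

  punchIn∈insertAt : ∀ {n} {T : Subset n} e {b i} → i ∈ T → punchIn e i ∈ insertAt T e b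
  punchIn∈insertAt {T = T} e {b} {i} i∈T =
    lookup⇒[]= (punchIn e i) (insertAt T e b) (trans (insertAt-punchIn T e b i) ([]=⇒lookup i∈T))

  -- Double counting and averaging.

  total : ∀ {n} → (Fin n → ℕ) → Subset n → ℕ
  total b []            = 0
  total b (inside  ∷ T) = b zero + total (b ∘ suc) T
  total b (outside ∷ T) = total (b ∘ suc) T

  total-≤ : ∀ {n} (b : Fin n → ℕ) T {g} → (∀ {i} → i ∈ T → b i ≤ g) → total b T ≤ ∣ T ∣ * g
  total-≤ b []            b≤g = z≤n
  total-≤ b (inside  ∷ T) b≤g = +-mono-≤ (b≤g here) (total-≤ (b ∘ suc) T (b≤g ∘ there))
  total-≤ b (outside ∷ T) b≤g = total-≤ (b ∘ suc) T (b≤g ∘ there)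

  -- Each of the `suc n` points lies in `n C k` sets of size `suc k`.
  ∑[]-total : ∀ {n} k (b : Fin (suc n) → ℕ) → ∑[ suc k ] (total b) ≡ (n C k) * sum b
  ∑[]-total {zero} zero b = trans (+-identityʳ (b zero + 0)) (sym (*-identityˡ (b zero + 0)))
  ∑[]-total {zero} (suc k) b = cong (_* sum b) (sym (k>n⇒nCk≡0 {0} {suc k} z<s))
  ∑[]-total {suc n} k b = begin
      ∑[ k ] (λ T → b zero + total b′ T) + ∑[ suc k ] (total b′)
        ≡⟨ cong (_+ ∑[ suc k ] (total b′)) (trans (∑[]-+ k (λ _ → b zero) (total b′))
                                                 (cong (_+ ∑[ k ] (total b′)) (∑[]-const (suc n) k (b zero)))) ⟩
      (suc n C k) * b zero + ∑[ k ] (total b′) + ∑[ suc k ] (total b′)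
        ≡⟨ +-assoc ((suc n C k) * b zero) _ _ ⟩
      (suc n C k) * b zero + (∑[ k ] (total b′) + ∑[ suc k ] (total b′))
        ≡⟨ cong ((suc n C k) * b zero +_) (tail k) ⟩
      (suc n C k) * b zero + (suc n C k) * sum b′
        ≡⟨ *-distribˡ-+ (suc n C k) (b zero) (sum b′) ⟨
      (suc n C k) * sum b ∎
    where
    open ≡-Reasoning
    b′ : Fin (suc n) → ℕ
    b′ = b ∘ suc

    ∑[0]-total : ∀ {m} (c : Fin m → ℕ) → ∑[ 0 ] (total c) ≡ 0
    ∑[0]-total {zero}  c = refl
    ∑[0]-total {suc m} c = ∑[0]-total (c ∘ suc)

    tail : ∀ k → ∑[ k ] (total b′) + ∑[ suc k ] (total b′) ≡ (suc n C k) * sum b′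
    tail zero    = trans (cong₂ _+_ (∑[0]-total b′) (∑[]-total 0 b′))
                         (cong (_* sum b′) (trans (nC0≡1 n) (sym (nC0≡1 (suc n)))))
    tail (suc k) = begin
      ∑[ suc k ] (total b′) + ∑[ 2+ k ] (total b′) ≡⟨ cong₂ _+_ (∑[]-total k b′) (∑[]-total (suc k) b′) ⟩
      (n C k) * sum b′ + (n C suc k) * sum b′       ≡⟨ *-distribʳ-+ (sum b′) (n C k) (n C suc k) ⟨
      (n C k + n C suc k) * sum b′                  ≡⟨ cong (_* sum b′) (nCk+nC[k+1]≡[n+1]C[k+1] n k) ⟩
      (suc n C suc k) * sum b′                      ∎

  -- Pairs of a point and a set of size `suc k` containing it, counted in both ways: the case of the
  -- constant 1 in `∑[]-total`.
  absorption : ∀ n k → suc k * (suc n C suc k) ≡ suc n * (n C k)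
  absorption n k = begin
      suc k * (suc n C suc k)              ≡⟨ cong (suc k *_) (*-identityʳ (suc n C suc k)) ⟨
      suc k * ((suc n C suc k) * 1)        ≡⟨ cong (suc k *_) (∑[]-const (suc n) (suc k) 1) ⟨
      suc k * ∑[_] {suc n} (suc k) (λ _ → 1) ≡⟨ ∑[]-* {suc n} (suc k) (suc k) (λ _ → 1) ⟨
      ∑[_] {suc n} (suc k) (λ _ → suc k * 1) ≡⟨ ≤-antisym (∑[]-mono {suc n} (suc k) (λ T e → ≤-reflexive (sym (ones T e))))
                                                         (∑[]-mono {suc n} (suc k) (λ T e → ≤-reflexive (ones T e))) ⟩
      ∑[_] {suc n} (suc k) (total (λ _ → 1)) ≡⟨ ∑[]-total k (λ _ → 1) ⟩
      (n C k) * sum {suc n} (λ _ → 1)      ≡⟨ cong ((n C k) *_) (sum-ones (suc n)) ⟩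
      (n C k) * suc n                      ≡⟨ *-comm (n C k) (suc n) ⟩
      suc n * (n C k)                      ∎
    where
    open ≡-Reasoning
    total-ones : ∀ {m} (T : Subset m) → total (λ _ → 1) T ≡ ∣ T ∣
    total-ones []            = refl
    total-ones (inside  ∷ T) = cong suc (total-ones T)
    total-ones (outside ∷ T) = total-ones T

    ones : ∀ T → ∣ T ∣ ≡ suc k → total (λ _ → 1) T ≡ suc k * 1
    ones T e = trans (total-ones T) (trans e (sym (*-identityʳ (suc k))))

    sum-ones : ∀ m → sum {m} (λ _ → 1) ≡ m
    sum-ones zero    = refl
    sum-ones (suc m) = cong suc (sum-ones m)

  -- `g T` is at least the mean of `b` over `T`, and over all `T` each index occurs equally often,
  -- so the means average to the mean of `b`.
  ∑[]-average : ∀ {p} k (b : Fin p → ℕ) (g : Subset p → ℕ) →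
    (∀ T → ∣ T ∣ ≡ suc k → ∀ {i} → i ∈ T → b i ≤ g T) → (p C suc k) * sum b ≤ p * ∑[ suc k ] g
  ∑[]-average {zero}  k b g b≤g = ≤-reflexive (*-zeroʳ (0 C suc k))
  ∑[]-average {suc p} k b g b≤g = *-cancelˡ-≤ (suc k) (begin
    suc k * ((suc p C suc k) * sum b)   ≡⟨ *-assoc (suc k) (suc p C suc k) (sum b) ⟨
    suc k * (suc p C suc k) * sum b     ≡⟨ cong (_* sum b) (absorption p k) ⟩
    suc p * (p C k) * sum b             ≡⟨ *-assoc (suc p) (p C k) (sum b) ⟩
    suc p * ((p C k) * sum b)           ≡⟨ cong (suc p *_) (∑[]-total k b) ⟨
    suc p * ∑[ suc k ] (total b)        ≤⟨ *-monoʳ-≤ (suc p) (∑[]-mono (suc k) bound) ⟩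
    suc p * ∑[ suc k ] (λ T → suc k * g T) ≡⟨ cong (suc p *_) (∑[]-* (suc k) (suc k) g) ⟩
    suc p * (suc k * ∑[ suc k ] g)      ≡⟨ x*[y*z]≡y*[x*z] (suc p) (suc k) _ ⟩
    suc k * (suc p * ∑[ suc k ] g)      ∎)
    where
    open ≤-Reasoning
    bound : ∀ T → ∣ T ∣ ≡ suc k → total b T ≤ suc k * g T
    bound T e = subst (λ s → total b T ≤ s * g T) e (total-≤ b T (b≤g T e))

  ∑[]-lower : ∀ {p} k c (g : Subset p → ℕ) →
    (∀ T → ∣ T ∣ ≡ k → c ≤ g T) → (p C k) * c ≤ ∑[ k ] g
  ∑[]-lower {p} k c g c≤g = ≤-trans (≤-reflexive (sym (∑[]-const p k c))) (∑[]-mono k c≤g)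

  -- The weighted inequality on subsets of `D`.

  -- N″, N, N′, M stand for p C (j + 1), p C j, p C (j ∸ 1), (p + 1) C j, and B / p is the average of
  -- the unexceptional a l. Both sides agree for X = Y = B, and increasing X or Y favours the right.
  weighted-bound : ∀ {p j N″ N N′ M B X Y SA SB SC SD c x} →
    M ≡ N + N′ → M ≤ suc j * N → suc j * (N″ + N + M) ≡ (2 + p) * M →
    N″ * B ≤ p * SA → N * X ≤ p * SB → N * Y ≤ p * SC → N′ * Y ≤ p * SD →
    p * x ≤ X → p * c ≤ Y → B ≤ X → B ≤ Y →
    M * (p * (c + (x + B))) ≤ suc j * (p * (SA + SB + SC + SD))
  weighted-bound {p} {j} {N″} {N} {N′} {M} {B} {X} {Y} {SA} {SB} {SC} {SD} {c} {x}
    M≡ M≤ balance A≤ B≤ C≤ D≤ px≤ pc≤ B≤X B≤Y with m≤n⇒∃[o]m+o≡n M≤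
  -- With `R` the excess of `suc j * N` over `M`, the weight `suc j * N` of `X` splits into `M` for
  -- `p * x` and `R` for `B`, and the weight `suc j * M` of `Y` into `M` for `p * c` and `j * M` for
  -- `B`.
  ... | R , M+R≡ = begin
      M * (p * (c + (x + B)))             ≡⟨ expand M p c x B ⟩
      M * (p * c) + M * (p * x) + p * M * B ≤⟨ +-monoˡ-≤ (p * M * B) (+-mono-≤ (*-monoʳ-≤ M pc≤) (*-monoʳ-≤ M px≤)) ⟩
      M * Y + M * X + p * M * B           ≡⟨ cong (λ z → M * Y + M * X + z * B) coefficient ⟩
      M * Y + M * X + (suc j * N″ + R + j * M) * B ≡⟨ split (M * Y) (M * X) (suc j * N″) R (j * M) B ⟩
      suc j * N″ * B + (M * X + R * B) + (M * Y + j * M * B)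
        ≤⟨ +-mono-≤ (+-monoʳ-≤ (suc j * N″ * B) (+-monoʳ-≤ (M * X) (*-monoʳ-≤ R B≤X)))
                    (+-monoʳ-≤ (M * Y) (*-monoʳ-≤ (j * M) B≤Y)) ⟩
      suc j * N″ * B + (M * X + R * X) + (M * Y + j * M * Y)
        ≡⟨ cong₂ (λ z w → suc j * N″ * B + z + w)
             (trans (sym (*-distribʳ-+ X M R)) (cong (_* X) M+R≡))
             (trans (sym (*-distribʳ-+ Y M (j * M))) (cong (λ z → suc j * z * Y) M≡)) ⟩
      suc j * N″ * B + suc j * N * X + suc j * (N + N′) * Y
        ≡⟨ collect (suc j) N″ N N′ B X Y ⟩
      suc j * (N″ * B + N * X + N * Y + N′ * Y)
        ≤⟨ *-monoʳ-≤ (suc j) (+-mono-≤ (+-mono-≤ (+-mono-≤ A≤ B≤) C≤) D≤) ⟩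
      suc j * (p * SA + p * SB + p * SC + p * SD)
        ≡⟨ factor (suc j) p SA SB SC SD ⟩
      suc j * (p * (SA + SB + SC + SD)) ∎
    where
    open ≤-Reasoning
    expand : ∀ M p c x B → M * (p * (c + (x + B))) ≡ M * (p * c) + M * (p * x) + p * M * B
    expand = solve-∀
    split : ∀ Y X n r m B → Y + X + (n + r + m) * B ≡ n * B + (X + r * B) + (Y + m * B)
    split = solve-∀
    collect : ∀ s N″ N N′ B X Y →
      s * N″ * B + s * N * X + s * (N + N′) * Y ≡ s * (N″ * B + N * X + N * Y + N′ * Y)
    collect = solve-∀
    factor : ∀ s p a b c d → s * (p * a + p * b + p * c + p * d) ≡ s * (p * (a + b + c + d))
    factor = solve-∀
    move : ∀ j N″ M R → 2 * M + (suc j * N″ + R + j * M) ≡ suc j * N″ + (M + R) + suc j * M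
    move = solve-∀
    unmove : ∀ j N″ N M → suc j * N″ + suc j * N + suc j * M ≡ suc j * (N″ + N + M)
    unmove = solve-∀
    -- The copies of `B` absorbed on the right match those on the left exactly: this is `balance`
    -- after cancelling `2 * M`.
    coefficient : p * M ≡ suc j * N″ + R + j * M
    coefficient = +-cancelˡ-≡ (2 * M) _ _ (sym (begin-equality
      2 * M + (suc j * N″ + R + j * M)     ≡⟨ move j N″ M R ⟩
      suc j * N″ + (M + R) + suc j * M     ≡⟨ cong (λ z → suc j * N″ + z + suc j * M) M+R≡ ⟩
      suc j * N″ + suc j * N + suc j * M   ≡⟨ unmove j N″ N M ⟩
      suc j * (N″ + N + M)                 ≡⟨ balance ⟩
      (2 + p) * M                          ≡⟨ *-distribʳ-+ M 2 p ⟩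
      2 * M + p * M                        ∎))

  *-⊔-lub : ∀ n {x y z} → n * x ≤ z → n * y ≤ z → n * (x ⊔ y) ≤ z
  *-⊔-lub n {x} {y} nx≤z ny≤z = ≤-trans (≤-reflexive (*-distribˡ-⊔ n x y)) (⊔-lub nx≤z ny≤z)

  -- Averaging the a l with l ≢ e over the rest of T needs T ≢ ⁅ e ⁆, which is where j ≥ 2 enters.
  subset-sum-bound : ∀ {m p} i → m ≡ suc p → 2 + i ≤ p →
    (g : Subset m → ℕ) (c : ℕ) (a : Fin m → ℕ) (e : Fin m) →
    (∀ T → ∣ T ∣ ≡ 3 + i → ∀ {l} → l ∈ T → a l ≤ g T) →
    (∀ T → ∣ T ∣ ≡ 2 + i → c ≤ g T) →
    (∀ T → ∣ T ∣ ≡ 2 + i → ∀ {l} → l ∈ T → l ≢ e → a l ≤ g T) →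
    ((2 + p) C (3 + i)) * (c + sum a) ≤ (2 + p) * ∑ g
  subset-sum-bound {p = p@(suc _)} i refl j≤p g c a e a≤g c≤g a≤g′ =
    *-cancelˡ-≤ (suc j) (begin
      suc j * (((2 + p) C suc j) * F)  ≡⟨ *-assoc (suc j) ((2 + p) C suc j) F ⟨
      suc j * ((2 + p) C suc j) * F    ≡⟨ cong (_* F) (absorption (suc p) j) ⟩
      (2 + p) * M * F                  ≡⟨ *-assoc (2 + p) M F ⟩
      (2 + p) * (M * F)                ≤⟨ *-monoʳ-≤ (2 + p) bound ⟩
      (2 + p) * (suc j * ∑ g)          ≡⟨ x*[y*z]≡y*[x*z] (2 + p) (suc j) (∑ g) ⟩
      suc j * ((2 + p) * ∑ g)          ∎)
    where
    open ≤-Reasoning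
    j N″ N N′ M F B SA SB SC SD : ℕ
    j  = 2 + i
    N″ = p C (3 + i)
    N  = p C (2 + i)
    N′ = p C (1 + i)
    M  = suc p C j
    F  = c + sum a

    b : Fin p → ℕ
    b l = a (punchIn e l)
    B = sum b

    g₁ g₀ : Subset p → ℕ
    g₁ T = g (insertAt T e inside)
    g₀ T = g (insertAt T e outside)
    -- Sets of size `suc j` avoiding and containing `e`, then sets of size `j` avoiding and
    -- containing `e`. Inserting `e` accounts for the lower index in `SB` and `SD`.
    SA = ∑[ 3 + i ] g₀
    SB = ∑[ 2 + i ] g₁
    SC = ∑[ 2 + i ] g₀
    SD = ∑[ 1 + i ] g₁

    size₁ : ∀ {k} T → ∣ T ∣ ≡ k → ∣ insertAt T e inside ∣ ≡ suc k
    size₁ T eq = trans (∣insertAt-inside∣ T e) (cong suc eq)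

    size₀ : ∀ {k} T → ∣ T ∣ ≡ k → ∣ insertAt T e outside ∣ ≡ k
    size₀ T eq = trans (∣insertAt-outside∣ T e) eq

    scale : ∀ n {x S} → n * x ≤ S → n * (p * x) ≤ p * S
    scale n {x} nx≤S = ≤-trans (≤-reflexive (x*[y*z]≡y*[x*z] n p x)) (*-monoʳ-≤ p nx≤S)

    M≡N+N′ : M ≡ N + N′
    M≡N+N′ = trans (sym (nCk+nC[k+1]≡[n+1]C[k+1] p (1 + i))) (+-comm N′ N)

    -- The ratio of these neighbouring coefficients is `j / (p + 1 - j)`, at most `j` because
    -- `j ≤ p`.
    N′≤jN : N′ ≤ j * N
    N′≤jN = +-cancelʳ-≤ (j * N′) N′ (j * N) (begin
      N′ + j * N′     ≤⟨ +-monoʳ-≤ N′ (*-monoˡ-≤ N′ j≤p) ⟩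
      suc p * N′      ≡⟨ absorption p (1 + i) ⟨
      j * M           ≡⟨ cong (j *_) M≡N+N′ ⟩
      j * (N + N′)    ≡⟨ *-distribˡ-+ j N N′ ⟩
      j * N + j * N′  ∎)

    -- Pascal's rule, applied twice, turns `N″ + N + M` into `(2 + p) C suc j`.
    balance : suc j * (N″ + N + M) ≡ (2 + p) * M
    balance = begin-equality
      suc j * (N″ + N + M)            ≡⟨ cong (λ z → suc j * (z + M)) (trans (+-comm N″ N) (nCk+nC[k+1]≡[n+1]C[k+1] p j)) ⟩
      suc j * ((suc p C suc j) + M)   ≡⟨ cong (suc j *_) (trans (+-comm (suc p C suc j) M) (nCk+nC[k+1]≡[n+1]C[k+1] (suc p) j)) ⟩
      suc j * ((2 + p) C suc j)       ≡⟨ absorption (suc p) j ⟩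
      (2 + p) * M                     ∎

    weighted : M * (p * (c + (a e + B))) ≤ suc j * (p * (SA + SB + SC + SD))
    -- `X` and `Y` are the larger of `p * a e` and `B`, and of `p * c` and `B`: sets containing `e`
    -- of size `suc j` dominate `a e` as well as the other `a l` in them, and sets of size `j`
    -- dominate `c` as well as the unexceptional `a l` in them.
    weighted = weighted-bound {p} {j} {N″} {N} {N′} M≡N+N′
      (≤-trans (≤-reflexive M≡N+N′) (+-monoʳ-≤ N N′≤jN)) balance
      (∑[]-average (2 + i) b g₀ (λ T eq l∈T →
        a≤g (insertAt T e outside) (size₀ T eq) (punchIn∈insertAt e l∈T)))
      (*-⊔-lub N
        (scale N (∑[]-lower (2 + i) (a e) g₁ (λ T eq →
          a≤g (insertAt T e inside) (size₁ T eq) (lookup⇒[]= e _ (insertAt-lookup T e inside)))))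
        (∑[]-average (1 + i) b g₁ (λ T eq l∈T →
          a≤g (insertAt T e inside) (size₁ T eq) (punchIn∈insertAt e l∈T))))
      (*-⊔-lub N
        (scale N (∑[]-lower (2 + i) c g₀ (λ T eq → c≤g (insertAt T e outside) (size₀ T eq))))
        (∑[]-average (1 + i) b g₀ (λ T eq l∈T →
          a≤g′ (insertAt T e outside) (size₀ T eq) (punchIn∈insertAt e l∈T) (Fin.punchInᵢ≢i e _))))
      (*-⊔-lub N′
        (scale N′ (∑[]-lower (1 + i) c g₁ (λ T eq → c≤g (insertAt T e inside) (size₁ T eq))))
        (∑[]-average i b g₁ (λ T eq l∈T →
          a≤g′ (insertAt T e inside) (size₁ T eq) (punchIn∈insertAt e l∈T) (Fin.punchInᵢ≢i e _))))
      (m≤m⊔n (p * a e) B) (m≤m⊔n (p * c) B) (m≤n⊔m (p * a e) B) (m≤n⊔m (p * c) B)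

    parts≤∑ : SA + SB + SC + SD ≤ ∑ g
    parts≤∑ = begin
      SA + SB + SC + SD     ≡⟨ rearrange SA SB SC SD ⟩
      (SD + SB) + (SC + SA) ≤⟨ +-mono-≤ (∑[k]+∑[1+k]≤∑ (1 + i) g₁) (∑[k]+∑[1+k]≤∑ (2 + i) g₀) ⟩
      ∑ g₁ + ∑ g₀           ≡⟨ ∑-insertAt e g ⟨
      ∑ g                   ∎
      where
      rearrange : ∀ a b c d → a + b + c + d ≡ (d + b) + (c + a)
      rearrange = solve-∀

    bound : M * F ≤ suc j * ∑ g
    bound = *-cancelˡ-≤ p (begin
      p * (M * F)                           ≡⟨ x*[y*z]≡y*[x*z] p M F ⟩
      M * (p * F)                           ≡⟨ cong (λ z → M * (p * (c + z))) (sum-remove {i = e} a) ⟩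
      M * (p * (c + (a e + B)))             ≤⟨ weighted ⟩
      suc j * (p * (SA + SB + SC + SD))     ≤⟨ *-monoʳ-≤ (suc j) (*-monoʳ-≤ p parts≤∑) ⟩
      suc j * (p * ∑ g)                     ≡⟨ x*[y*z]≡y*[x*z] (suc j) p (∑ g) ⟩
      p * (suc j * ∑ g)                     ∎)

  -- Counting a family by traces on a fixed set.

  card≡# : ∀ {n} {𝓕 : Family n} (𝓕? : Decidable 𝓕) → card 𝓕? ≡ # (λ X → ⌊ 𝓕? X ⌋)
  card≡# {n} 𝓕? = trans (length-filter≡sum (subsets n)) (sum-subsets≡∑ (λ X → ind ⌊ 𝓕? X ⌋))
    where
    length-filter≡sum : ∀ Xs → List.length (List.filter 𝓕? Xs) ≡ ℕ.sum (List.map (λ X → ind ⌊ 𝓕? X ⌋) Xs)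
    length-filter≡sum List.[]       = refl
    length-filter≡sum (X List.∷ Xs) with 𝓕? X
    ... | yes _ = cong suc (length-filter≡sum Xs)
    ... | no  _ = length-filter≡sum Xs

    sum-subsets≡∑ : ∀ {m} (f : Subset m → ℕ) → ℕ.sum (List.map f (subsets m)) ≡ ∑ f
    sum-subsets≡∑ {zero}  f = +-identityʳ (f [])
    sum-subsets≡∑ {suc m} f = begin
      ℕ.sum (List.map f (ins List.++ outs))            ≡⟨ cong ℕ.sum (map-++ f ins outs) ⟩
      ℕ.sum (List.map f ins List.++ List.map f outs)   ≡⟨ sum-++ (List.map f ins) (List.map f outs) ⟩
      ℕ.sum (List.map f ins) + ℕ.sum (List.map f outs)
        ≡⟨ cong₂ (λ a b → ℕ.sum a + ℕ.sum b) (map-∘ (subsets m)) (map-∘ (subsets m)) ⟨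
      ℕ.sum (List.map (f ∘ (inside ∷_)) (subsets m)) + ℕ.sum (List.map (f ∘ (outside ∷_)) (subsets m))
        ≡⟨ cong₂ _+_ (sum-subsets≡∑ (f ∘ (inside ∷_))) (sum-subsets≡∑ (f ∘ (outside ∷_))) ⟩
      ∑ f ∎
      where
      open ≡-Reasoning
      ins outs : List.List (Subset (suc m))
      ins  = List.map (inside ∷_) (subsets m)
      outs = List.map (outside ∷_) (subsets m)

  ∑-⊥ : ∀ {n} (f : Subset n → ℕ) → (∀ T → 1 ≤ ∣ T ∣ → f T ≡ 0) → ∑ f ≡ f ⊥
  ∑-⊥ {zero}  f f≡0 = refl
  ∑-⊥ {suc n} f f≡0 = cong₂ _+_ (∑-zero (λ T → f≡0 (inside ∷ T) (s≤s z≤n)))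
                                (∑-⊥ (f ∘ (outside ∷_)) (f≡0 ∘ (outside ∷_)))

  ∑-⊥-singletons : ∀ {n} (f : Subset n → ℕ) → (∀ T → 2 ≤ ∣ T ∣ → f T ≡ 0) →
                   ∑ f ≡ f ⊥ + sum (f ∘ ⁅_⁆)
  ∑-⊥-singletons {zero}  f f≡0 = sym (+-identityʳ (f []))
  ∑-⊥-singletons {suc n} f f≡0 = begin
      ∑ (f ∘ (inside ∷_)) + ∑ f₀           ≡⟨ cong₂ _+_ (∑-⊥ _ (λ T 1≤ → f≡0 (inside ∷ T) (s≤s 1≤)))
                                                       (∑-⊥-singletons f₀ (f≡0 ∘ (outside ∷_))) ⟩
      f ⁅ zero ⁆ + (f₀ ⊥ + sum (f₀ ∘ ⁅_⁆)) ≡⟨ x+[y+z]≡y+[x+z] (f ⁅ zero ⁆) (f₀ ⊥) _ ⟩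
      f₀ ⊥ + (f ⁅ zero ⁆ + sum (f₀ ∘ ⁅_⁆)) ∎
    where
    open ≡-Reasoning
    f₀ : Subset n → ℕ
    f₀ = f ∘ (outside ∷_)

  -- The set with trace `S` on `D` and trace `X` off `D`, the points of each side being renumbered
  -- in order.
  merge : ∀ {n} (D : Subset n) → Subset ∣ D ∣ → Subset ∣ ∁ D ∣ → Subset n
  merge []            S       X       = []
  merge (inside  ∷ D) (s ∷ S) X       = s ∷ merge D S X
  merge (outside ∷ D) S       (x ∷ X) = x ∷ merge D S X

  ∑-merge : ∀ {n} (D : Subset n) (f : Subset n → ℕ) → ∑ f ≡ ∑ (λ S → ∑ (λ X → f (merge D S X)))
  ∑-merge []            f = refl
  ∑-merge (inside  ∷ D) f = cong₂ _+_ (∑-merge D (f ∘ (inside ∷_))) (∑-merge D (f ∘ (outside ∷_)))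
  ∑-merge (outside ∷ D) f =
    trans (cong₂ _+_ (∑-merge D (f ∘ (inside ∷_))) (∑-merge D (f ∘ (outside ∷_))))
          (sym (∑-+ (λ S → ∑ (λ X → f (inside ∷ merge D S X))) _))

  merge-∩ : ∀ {n} (D : Subset n) S X S′ X′ →
            merge D S X ∩ merge D S′ X′ ≡ merge D (S ∩ S′) (X ∩ X′)
  merge-∩ []            []      []      []        []        = refl
  merge-∩ (inside  ∷ D) (s ∷ S) X       (s′ ∷ S′) X′        = cong (_ ∷_) (merge-∩ D S X S′ X′)
  merge-∩ (outside ∷ D) S       (x ∷ X) S′        (x′ ∷ X′) = cong (_ ∷_) (merge-∩ D S X S′ X′)

  ∣merge∣ : ∀ {n} (D : Subset n) S X → ∣ merge D S X ∣ ≡ ∣ S ∣ + ∣ X ∣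
  ∣merge∣ []            []            []            = refl
  ∣merge∣ (inside  ∷ D) (inside  ∷ S) X             = cong suc (∣merge∣ D S X)
  ∣merge∣ (inside  ∷ D) (outside ∷ S) X             = ∣merge∣ D S X
  ∣merge∣ (outside ∷ D) S             (inside  ∷ X) =
    trans (cong suc (∣merge∣ D S X)) (sym (+-suc (∣ S ∣) (∣ X ∣)))
  ∣merge∣ (outside ∷ D) S             (outside ∷ X) = ∣merge∣ D S X

  ∣merge∩D∣ : ∀ {n} (D : Subset n) S X → ∣ merge D S X ∩ D ∣ ≡ ∣ S ∣
  ∣merge∩D∣ []            []            []            = refl
  ∣merge∩D∣ (inside  ∷ D) (inside  ∷ S) X             = cong suc (∣merge∩D∣ D S X)
  ∣merge∩D∣ (inside  ∷ D) (outside ∷ S) X             = ∣merge∩D∣ D S X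
  ∣merge∩D∣ (outside ∷ D) S             (inside  ∷ X) = ∣merge∩D∣ D S X
  ∣merge∩D∣ (outside ∷ D) S             (outside ∷ X) = ∣merge∩D∣ D S X

  merge-⊆ : ∀ {n} (D : Subset n) {S X S′ X′} → S ⊆ S′ → X ⊆ X′ → merge D S X ⊆ merge D S′ X′
  merge-⊆ D {S} {X} {S′} {X′} S⊆S′ X⊆X′ =
    subst (_⊆ merge D S′ X′)
      (trans (merge-∩ D S X S′ X′) (cong₂ (merge D) (⊆⇒∩≡ S⊆S′) (⊆⇒∩≡ X⊆X′)))
      (p∩q⊆q (merge D S X) (merge D S′ X′))
    where
    ⊆⇒∩≡ : ∀ {m} {P Q : Subset m} → P ⊆ Q → P ∩ Q ≡ P
    ⊆⇒∩≡ {P = P} {Q} P⊆Q = ⊆-antisym (p∩q⊆p P Q) (λ x∈P → x∈p∩q⁺ (x∈P , P⊆Q x∈P))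

  ∣∁p∣+∣p∣≡n : ∀ {n} (P : Subset n) → ∣ ∁ P ∣ + ∣ P ∣ ≡ n
  ∣∁p∣+∣p∣≡n P = trans (cong (_+ ∣ P ∣) (∣∁p∣≡n∸∣p∣ P)) (m∸n+n≡m (∣p∣≤n P))

  ⁅x⁆⊆ : ∀ {n} {x : Fin n} {P} → x ∈ P → ⁅ x ⁆ ⊆ P
  ⁅x⁆⊆ {x = x} {P} x∈P y∈⁅x⁆ = subst (_∈ P) (sym (x∈⁅y⁆⇒x≡y x y∈⁅x⁆)) x∈P

  ∣∁⁅x⁆∩∁⁅y⁆∣ : ∀ {n} {x y : Fin n} → x ≢ y → 2 + ∣ ∁ ⁅ x ⁆ ∩ ∁ ⁅ y ⁆ ∣ ≤ n
  ∣∁⁅x⁆∩∁⁅y⁆∣ {n} {x} {y} x≢y = begin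
      2 + ∣ ∁ ⁅ x ⁆ ∩ ∁ ⁅ y ⁆ ∣  ≤⟨ s≤s (p⊂q⇒∣p∣<∣q∣ proper) ⟩
      1 + ∣ ∁ ⁅ x ⁆ ∣            ≡⟨ trans (+-comm 1 _) (cong (∣ ∁ ⁅ x ⁆ ∣ +_) (sym (∣⁅x⁆∣≡1 x))) ⟩
      ∣ ∁ ⁅ x ⁆ ∣ + ∣ ⁅ x ⁆ ∣    ≡⟨ ∣∁p∣+∣p∣≡n ⁅ x ⁆ ⟩
      n                          ∎
    where
    open ≤-Reasoning
    proper : ∁ ⁅ x ⁆ ∩ ∁ ⁅ y ⁆ ⊂ ∁ ⁅ x ⁆
    proper = p∩q⊆p _ _ , y , x∉p⇒x∈∁p (x≢y⇒x∉⁅y⁆ (x≢y ∘ sym))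
           , λ y∈ → x∈∁p⇒x∉p (proj₂ (x∈p∩q⁻ _ _ y∈)) (x∈⁅x⁆ y)

  -- Links of a semistar and of its shadow.

  -- Members of 𝓕 and of its shadow are sorted by the part of D that they miss.
  module Semistar {n k t : ℕ} {𝓕 : Family n} (𝓕? : Decidable 𝓕)
    (uniform : Uniform k 𝓕) (intersecting : Intersecting t 𝓕)
    (D : Subset n) (∣D∣≡1+t : ∣ D ∣ ≡ suc t) (semistar : ∀ {F} → 𝓕 F → t ≤ ∣ F ∩ D ∣)
    (i : ℕ) (2+i<t : 2 + i < t) where

    j m : ℕ
    j = 2 + i
    m = ∣ D ∣

    link : ∀ {𝓖 : Family n} → Decidable 𝓖 → Subset m → Fam ∣ ∁ D ∣
    link 𝓖? T X = ⌊ 𝓖? (merge D (∁ T) X) ⌋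

    A : Fin m → Fam ∣ ∁ D ∣
    A l = link 𝓕? ⁅ l ⁆

    S? : Decidable (shadow k j 𝓕)
    S? = shadow? k j 𝓕?

    card≡∑link : ∀ {𝓖 : Family n} (𝓖? : Decidable 𝓖) → card 𝓖? ≡ ∑ (λ T → # (link 𝓖? T))
    card≡∑link 𝓖? = trans (card≡# 𝓖?) (trans (∑-merge D (λ F → ind ⌊ 𝓖? F ⌋)) (∑-∁ {m} _))

    -- Inside `D` the two members share only the `t - 1` points other than `l` and `l′`, so a
    -- further common point lies outside `D`.
    cross : ∀ {l l′} → l ≢ l′ → Cross (A l) (A l′)
    cross {l} {l′} l≢l′ X Y X∈A Y∈A = +-cancelˡ-≤ (∣ U ∣) 1 (∣ X ∩ Y ∣) (begin
        ∣ U ∣ + 1          ≡⟨ +-comm (∣ U ∣) 1 ⟩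
        1 + ∣ U ∣          ≤⟨ s≤s⁻¹ (≤-trans (∣∁⁅x⁆∩∁⁅y⁆∣ l≢l′) (≤-reflexive ∣D∣≡1+t)) ⟩
        t                  ≤⟨ intersecting (toWitness X∈A) (toWitness Y∈A) ⟩
        ∣ merge D (∁ ⁅ l ⁆) X ∩ merge D (∁ ⁅ l′ ⁆) Y ∣
                           ≡⟨ cong ∣_∣ (merge-∩ D (∁ ⁅ l ⁆) X (∁ ⁅ l′ ⁆) Y) ⟩
        ∣ merge D U (X ∩ Y) ∣  ≡⟨ ∣merge∣ D U (X ∩ Y) ⟩
        ∣ U ∣ + ∣ X ∩ Y ∣  ∎)
      where
      open ≤-Reasoning
      U : Subset m
      U = ∁ ⁅ l ⁆ ∩ ∁ ⁅ l′ ⁆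

    -- Missing `V` instead of `U` deletes `∣ V ∣ - ∣ U ∣` points of `D`, and passing from `Y` to `X`
    -- deletes the rest; the size condition, written additively, says that `j` points go in all.
    link-shadow : ∀ {U V X Y} → U ⊆ V → X ⊆ Y → ∣ V ∣ + ∣ Y ∣ ≡ ∣ U ∣ + ∣ X ∣ + j →
                  T (link 𝓕? U Y) → T (link S? V X)
    link-shadow {U} {V} {X} {Y} U⊆V X⊆Y sizes Y∈ = fromWitness
      ( +-cancelʳ-≡ (∣ V ∣ + ∣ U ∣) (∣ merge D (∁ V) X ∣ + j) k (begin
          ∣ merge D (∁ V) X ∣ + j + (∣ V ∣ + ∣ U ∣)
            ≡⟨ cong (λ z → z + j + (∣ V ∣ + ∣ U ∣)) (∣merge∣ D (∁ V) X) ⟩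
          ∣ ∁ V ∣ + ∣ X ∣ + j + (∣ V ∣ + ∣ U ∣)
            ≡⟨ move (∣ ∁ V ∣) (∣ X ∣) j (∣ V ∣) (∣ U ∣) ⟩
          (∣ ∁ V ∣ + ∣ V ∣) + (∣ U ∣ + ∣ X ∣ + j)
            ≡⟨ cong₂ _+_ (trans (∣∁p∣+∣p∣≡n V) (sym (∣∁p∣+∣p∣≡n U))) (sym sizes) ⟩
          (∣ ∁ U ∣ + ∣ U ∣) + (∣ V ∣ + ∣ Y ∣)
            ≡⟨ unmove (∣ ∁ U ∣) (∣ U ∣) (∣ V ∣) (∣ Y ∣) ⟩
          (∣ ∁ U ∣ + ∣ Y ∣) + (∣ V ∣ + ∣ U ∣)
            ≡⟨ cong (_+ (∣ V ∣ + ∣ U ∣)) (trans (sym (∣merge∣ D (∁ U) Y)) (uniform (toWitness Y∈))) ⟩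
          k + (∣ V ∣ + ∣ U ∣) ∎)
      , merge D (∁ U) Y , toWitness Y∈ , λ {x} → merge-⊆ D (p⊆q⇒∁p⊇∁q U⊆V) X⊆Y)
      where
      open ≡-Reasoning
      move : ∀ a b c d e → a + b + c + (d + e) ≡ (a + d) + (e + b + c)
      move = solve-∀
      unmove : ∀ a b c d → (a + b) + (c + d) ≡ (a + d) + (c + b)
      unmove = solve-∀

    -- All `j` deletions happen in `D`, at the points of `V` other than `l`.
    singleton-≤ : ∀ V → ∣ V ∣ ≡ suc j → ∀ {l} → l ∈ V → # (A l) ≤ # (link S? V)
    singleton-≤ V ∣V∣ {l} l∈V = #-mono (λ X → link-shadow (⁅x⁆⊆ l∈V) id (sizes X))
      where
      sizes : (X : Subset ∣ ∁ D ∣) → ∣ V ∣ + ∣ X ∣ ≡ ∣ ⁅ l ⁆ ∣ + ∣ X ∣ + j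
      sizes X = trans (cong (_+ ∣ X ∣) ∣V∣) (trans (cong suc (+-comm j ∣ X ∣))
        (cong (λ z → z + ∣ X ∣ + j) (sym (∣⁅x⁆∣≡1 l))))

    ⊥-≤ : ∀ V → ∣ V ∣ ≡ j → # (link 𝓕? ⊥) ≤ # (link S? V)
    ⊥-≤ V ∣V∣ = #-mono (λ X → link-shadow ⊥⊆ id (sizes X))
      where
      sizes : (X : Subset ∣ ∁ D ∣) → ∣ V ∣ + ∣ X ∣ ≡ ∣ ⊥ {m} ∣ + ∣ X ∣ + j
      sizes X = trans (cong (_+ ∣ X ∣) ∣V∣) (trans (+-comm j ∣ X ∣)
        (cong (λ z → z + ∣ X ∣ + j) (sym (∣⊥∣≡0 m))))

    -- Here `j - 1` deletions happen in `D`, and the remaining one is that which forms `∂`.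
    ∂-singleton-≤ : ∀ V → ∣ V ∣ ≡ j → ∀ {l} → l ∈ V → # (∂ (A l)) ≤ # (link S? V)
    ∂-singleton-≤ V ∣V∣ {l} l∈V = #-mono λ X X∈∂ →
      let Y , Y∈A , X⊆Y , ∣Y∣ = ∂-sound (A l) X X∈∂
      in link-shadow (⁅x⁆⊆ l∈V) X⊆Y (sizes X Y ∣Y∣) Y∈A
      where
      sizes : (X Y : Subset ∣ ∁ D ∣) → ∣ Y ∣ ≡ suc ∣ X ∣ → ∣ V ∣ + ∣ Y ∣ ≡ ∣ ⁅ l ⁆ ∣ + ∣ X ∣ + j
      sizes X Y ∣Y∣ = trans (cong₂ _+_ ∣V∣ ∣Y∣) (trans (+-comm j (suc ∣ X ∣))
        (cong (λ z → z + ∣ X ∣ + j) (sym (∣⁅x⁆∣≡1 l))))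

    -- Two distinct links that both outnumber their shadows would contradict `cross⇒shadow`.
    exceptional : ∃[ e ] (∀ {l} → l ≢ e → # (A l) ≤ # (∂ (A l)))
    exceptional with Fin.any? (λ e → # (∂ (A e)) <? # (A e))
    ... | yes (e , ∂<) = e , λ {l} l≢e →
      [ id , (λ p → contradiction p (<⇒≱ ∂<)) ]′ (cross⇒shadow (A l) (A e) (cross l≢e))
    -- Every link satisfies the bound, so any point of `D` may serve as `e`; one exists because `D`
    -- has `suc t` points.
    ... | no none = subst Fin (sym ∣D∣≡1+t) zero , λ {l} _ → ≮⇒≥ (λ ∂< → none (l , ∂<))

    -- A member missing two points of `D` would meet `D` in fewer than `t` points, so only the links
    -- of `⊥` and of singletons contribute.
    card𝓕 : card 𝓕? ≡ # (link 𝓕? ⊥) + sum (λ l → # (A l))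
    card𝓕 = trans (card≡∑link 𝓕?) (∑-⊥-singletons (λ T → # (link 𝓕? T)) λ T 2≤∣T∣ →
        ∑-zero (λ X → empty T X 2≤∣T∣))
      where
      empty : ∀ T X → 2 ≤ ∣ T ∣ → ind (link 𝓕? T X) ≡ 0
      empty T X 2≤∣T∣ with 𝓕? (merge D (∁ T) X)
      ... | no  _  = refl
      ... | yes F∈ = contradiction (begin
        2 + t             ≡⟨ +-comm 2 t ⟩
        t + 2             ≤⟨ +-mono-≤ (semistar F∈) 2≤∣T∣ ⟩
        ∣ merge D (∁ T) X ∩ D ∣ + ∣ T ∣ ≡⟨ cong (_+ ∣ T ∣) (∣merge∩D∣ D (∁ T) X) ⟩
        ∣ ∁ T ∣ + ∣ T ∣   ≡⟨ trans (∣∁p∣+∣p∣≡n T) ∣D∣≡1+t ⟩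
        suc t             ∎) (<⇒≱ (n<1+n (suc t)))
        where open ≤-Reasoning

    -- The claim with denominators cleared; the `p` of `subset-sum-bound` is `t`, as `D` has `t + 1`
    -- points.
    card-bound : ((2 + t) C (1 + j)) * card 𝓕? ≤ (2 + t) * card S?
    card-bound = let e , ∂≥ = exceptional in
      subst₂ _≤_ (cong (((2 + t) C (1 + j)) *_) (sym card𝓕)) (cong ((2 + t) *_) (sym (card≡∑link S?)))
        (subset-sum-bound i ∣D∣≡1+t (<⇒≤ 2+i<t) (λ V → # (link S? V)) (# (link 𝓕? ⊥)) (λ l → # (A l)) e
          singleton-≤ ⊥-≤
          (λ V ∣V∣ l∈V l≢e → ≤-trans (∂≥ l≢e) (∂-singleton-≤ V ∣V∣ l∈V)))

  -- From natural numbers to rational ratios.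

  -- Normalised fractions hide their numerators, so the comparison is made between unnormalised
  -- ones, where it is plain cross-multiplication.
  ratio-≤ : ∀ s c f d .{{_ : NonZero f}} .{{_ : NonZero d}} → c * f ≤ d * s →
            (ℤ.+ 1 ℚ./ d) ℚ.* (ℤ.+ c ℚ./ 1) ℚ.≤ ℤ.+ s ℚ./ f
  ratio-≤ s c f@(suc _) d@(suc _) cf≤ds = ℚ.toℚᵘ-cancel-≤ (begin
      ℚ.toℚᵘ ((ℤ.+ 1 ℚ./ d) ℚ.* (ℤ.+ c ℚ./ 1))
        ≃⟨ ℚ.toℚᵘ-homo-* (ℤ.+ 1 ℚ./ d) (ℤ.+ c ℚ./ 1) ⟩
      ℚ.toℚᵘ (ℤ.+ 1 ℚ./ d) ℚᵘ.* ℚ.toℚᵘ (ℤ.+ c ℚ./ 1)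
        ≃⟨ ℚᵘ.*-cong (ℚ.toℚᵘ-fromℚᵘ (ℤ.+ 1 ℚᵘ./ d)) (ℚ.toℚᵘ-fromℚᵘ (ℤ.+ c ℚᵘ./ 1)) ⟩
      (ℤ.+ 1 ℚᵘ./ d) ℚᵘ.* (ℤ.+ c ℚᵘ./ 1)
        ≤⟨ ℚᵘ.*≤* (subst₂ ℤ._≤_ (trans (ℤ.pos-* (1 * c) f) (cong (ℤ._* (ℤ.+ f)) (ℤ.pos-* 1 c)))
                    (ℤ.pos-* s (d * 1)) (ℤ.+≤+ cross-multiplied)) ⟩
      ℤ.+ s ℚᵘ./ f
        ≃⟨ ℚ.toℚᵘ-fromℚᵘ (ℤ.+ s ℚᵘ./ f) ⟨
      ℚ.toℚᵘ (ℤ.+ s ℚ./ f) ∎)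
    where
    open ℚᵘ.≤-Reasoning
    cross-multiplied : 1 * c * f ≤ s * (d * 1)
    cross-multiplied = subst₂ _≤_ (cong (_* f) (sym (*-identityˡ c)))
      (trans (*-comm d s) (cong (s *_) (sym (*-identityʳ d)))) cf≤ds

open import Defs
open import Data.Integer.Base using (+_)
open import Data.Nat.Base using (ℕ; zero; suc; _<_; _+_; s≤s)
open import Data.Nat.Combinatorics using (_C_)
open import Data.Product.Base using (_,_)
open import Data.Rational.Base using (_/_; _*_; _≥_)
open import Relation.Unary using (Decidable; Satisfiable)
open SemistarShadow using (module Semistar; ratio-≤)

theorem5p5 : ∀ {n k t : ℕ} → 0 < t → t < k → k < n →
    ∀ {𝓕 : Family n} (𝓕? : Decidable 𝓕) (𝓕≢∅ : Satisfiable 𝓕) →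
    Uniform k 𝓕 → Intersecting t 𝓕 → SucSemistar t 𝓕 →
    ∀ (j : ℕ) → 1 < j → j < t →
    _/_ (+ card (shadow? k j 𝓕?)) (card 𝓕?) {{card-nonZero 𝓕? 𝓕≢∅}}
    ≥ (+ 1 / (2 + t)) * (+ ((2 + t) C (1 + j)) / 1)
theorem5p5 _ _ _ _ _ _ _ _ (suc zero) (s≤s ()) _
theorem5p5 {k = k} {t} _ _ _ 𝓕? 𝓕≢∅ uniform intersecting (D , ∣D∣ , semistar) j@(suc (suc i)) _ j<t =
  ratio-≤ (card (shadow? k j 𝓕?)) ((2 + t) C (1 + j)) (card 𝓕?) (2 + t) {{card-nonZero 𝓕? 𝓕≢∅}}
    (Semistar.card-bound 𝓕? uniform intersecting D ∣D∣ semistar i j<t)
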